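{- The labelled transition system of processes of $\pi$LL enjoys erasure with respect to the labelled transition system of typing derivations of $\pi$LL. That is, for every typing derivation $D$ and every label $l$: (i) if $D\xrightarrow{l}D'$ then $\mathrm{proc}(D)\xrightarrow{l}\mathrm{proc}(D')$; and (ii) if $\mathrm{proc}(D)\xrightarrow{l}P'$ then there is a derivation $D'$ with $D\xrightarrow{l}D'$ and $\mathrm{proc}(D')=P'$.
   Context: **Syntax.** Names $x,y,z,\ldots$ are drawn from an infinite set with decidable equality; $X$ ranges over type variables. Types: $A,B::=A\otimes B\mid A\wp B\mid 1\mid\bot\mid A\oplus B\mid A\&B\mid X\mid X^\perp\mid\exists X.A\mid\forall X.A\mid{?}A\mid{!}A$ ($\wp$ is the "par" connective). Processes: $P,Q::=x[y].P\mid x(y).P\mid x[].P\mid x().P\mid x[\mathsf{inl}].P\mid x[\mathsf{inr}].P\mid x\triangleright(P,Q)\mid x[A].P\mid x(X).P\mid{!}x(y).P\mid{?}x[y].P\mid{?}x[x_1,x_2].P\mid{?}x[].P\mid(\nu xy)P\mid P\parallel Q\mid\mathbf 0\mid x\leftrightarrow y$. Names written inside $[\cdot]$ or $(\cdot)$ of a prefix are bound in its continuation, $x,y$ are bound in $(\nu xy)P$, $X$ is bound in $x(X).P$; free names $\mathrm{fn}(P)$ and $=_\alpha$ are as usual, and $(\nu xy)P$ is identified with $(\nu yx)P$. **Typing.** Duality is the involution with $(A\otimes B)^\perp=A^\perp\wp B^\perp$, $1^\perp=\bot$, $(A\oplus B)^\perp=A^\perp\&B^\perp$, $({?}A)^\perp={!}A^\perp$,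 $(\exists X.A)^\perp=\forall X.A^\perp$, $(X)^\perp=X^\perp$, and symmetrically. An environment $\Gamma,\Delta,\ldots$ is a finite unordered list $x_1:A_1,\ldots,x_k:A_k$ of distinct names with types; "," joins environments with disjoint names. A hyperenvironment $\mathcal G=\Gamma_1\parallel\cdots\parallel\Gamma_n$ is a finite multiset of environments, all names distinct; $\emptyset$ is the hyperenvironment with no environments ("," binds tighter than $\parallel$). ${?}\Gamma$ denotes an environment all of whose types have the form ${?}A$. Typing rules (premises $\Rightarrow$ conclusion): (Ax) $\vdash x\leftrightarrow y::x:A^\perp,y:A$. (Cut) $\vdash P::\mathcal G\parallel\Gamma,x:A\parallel\Delta,y:A^\perp\Rightarrow\ \vdash(\nu xy)P::\mathcal G\parallel\Gamma,\Delta$. (Mix) $\vdash P::\mathcal G$ and $\vdash Q::\mathcal H\Rightarrow\ \vdash P\parallel Q::\mathcal G\parallel\mathcal H$. (Mix$_0$) $\vdash\mathbf 0::\emptyset$. ($\otimes$) $\vdash P::\Gamma,y:A\parallel\Delta,x:B\Rightarrow\ \vdash x[y].P::\Gamma,\Delta,x:A\otimes B$. (1) $\vdash P::\emptyset\Rightarrow\ \vdash x[].P::x:1$. ($\wp$) $\vdash P::\Gamma,y:A,x:B\Rightarrow\ \vdash x(y).P::\Gamma,x:A\wp B$. ($\bot$) $\vdash P::\Gamma\Rightarrow\ \vdash x().P::\Gamma,x:\bot$. ($\oplus_1$) $\vdash P::\Gamma,x:A\Rightarrow\ \vdash x[\mathsf{inl}].P::\Gamma,x:A\oplus B$. ($\oplus_2$)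 $\vdash P::\Gamma,x:B\Rightarrow\ \vdash x[\mathsf{inr}].P::\Gamma,x:A\oplus B$. ($\&$) $\vdash P::\Gamma,x:A$ and $\vdash Q::\Gamma,x:B\Rightarrow\ \vdash x\triangleright(P,Q)::\Gamma,x:A\&B$. (!) $\vdash P::{?}\Gamma,y:A\Rightarrow\ \vdash{!}x(y).P::{?}\Gamma,x:{!}A$. (?) $\vdash P::\Gamma,y:A\Rightarrow\ \vdash{?}x[y].P::\Gamma,x:{?}A$. (W) $\vdash P::\Gamma\Rightarrow\ \vdash{?}x[].P::\Gamma,x:{?}A$. (C) $\vdash P::\Gamma,x_1:{?}A,x_2:{?}A\Rightarrow\ \vdash{?}x[x_1,x_2].P::\Gamma,x:{?}A$. ($\exists$) $\vdash P::\Gamma,x:B\{A/X\}\Rightarrow\ \vdash x[A].P::\Gamma,x:\exists X.B$. ($\forall$) $\vdash P::\Gamma,x:B$, $X$ not free in $\Gamma$ $\Rightarrow\ \vdash x(X).P::\Gamma,x:\forall X.B$. A typing derivation $D$ is a finite tree built with these rules; $\mathrm{proc}(D)$ is the process in its conclusion. **Labels.** Action labels (Act): $x[]$, $x()$, $x[y]$, $x(y)$, $x[\mathsf{inl}]$, $x(\mathsf{inl})$, $x[\mathsf{inr}]$, $x(\mathsf{inr})$, ${?}x[y]$, ${!}x(y)$, ${?}x[x_1,x_2]$, ${!}x(x_1,x_2)$, ${?}x[]$, ${!}x()$, $x[A]$, $x(A)$. Labels: $\tau$, $x\leftrightarrow y$, $l$, and unordered pairs $l\parallel l'$, for $l,l'\in$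 Act. In an action label $x$ is free and the names inside brackets are bound; both names of $x\leftrightarrow y$ are free; $\mathrm{fn},\mathrm{bn}$ of a pair are unions; $\mathrm{cn}(l)=\mathrm{fn}(l)\cup\mathrm{bn}(l)$. **Process transitions** (least relation closed under): $\pi.P\xrightarrow{\pi}P$ for $\pi$ of the form $x[y],x(y),x[],x(),x[\mathsf{inl}],x[\mathsf{inr}],x[A],{?}x[y],{!}x(y)$; $x\triangleright(P,Q)\xrightarrow{x(\mathsf{inl})}P$; $x\triangleright(P,Q)\xrightarrow{x(\mathsf{inr})}Q$; $x(X).P\xrightarrow{x(A)}P\{A/X\}$; ${?}x[].P\xrightarrow{{?}x[]}x().P$; ${?}x[x_1,x_2].P\xrightarrow{{?}x[x_1,x_2]}x_1(x_2).P$; ${!}x(x').P\xrightarrow{{!}x()}{?}z_1[].\cdots{?}z_n[].x[].\mathbf 0$ if $\mathrm{fn}(P)\setminus\{x'\}=\{z_1,\ldots,z_n\}$; ${!}x(x').P\xrightarrow{{!}x(x_1,x_2)}{?}z_1[z_1\sigma_1,z_1\sigma_2].\cdots{?}z_n[z_n\sigma_1,z_n\sigma_2].x_1[x_2].({!}x_1(x'\sigma_1).P\sigma_1\parallel{!}x_2(x'\sigma_2).P\sigma_2)$ if $\sigma_1,\sigma_2$ are name substitutions with $\mathrm{fn}(P\sigma_1)\cap\mathrm{fn}(P\sigma_2)=\emptyset$ and $\mathrm{fn}(P)\setminus\{x'\}=\{z_1,\ldots,z_n\}$; $x\leftrightarrow y\xrightarrow{x\leftrightarrow y}\mathbf 0$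 and $x\leftrightarrow y\xrightarrow{y\leftrightarrow x}\mathbf 0$. ($\alpha$) if $P=_\alpha Q$ and $Q\xrightarrow{l}R$ then $P\xrightarrow{l}R$. (Par) if $P\xrightarrow{l}P'$ and $\mathrm{bn}(l)\cap\mathrm{fn}(Q)=\emptyset$ then $P\parallel Q\xrightarrow{l}P'\parallel Q$; symmetrically on the right. (Syn) if $P\xrightarrow{l}P'$, $Q\xrightarrow{l'}Q'$, $l,l'\in$ Act, $\mathrm{bn}(l)\cap\mathrm{bn}(l')=\emptyset$ then $P\parallel Q\xrightarrow{l\parallel l'}P'\parallel Q'$. (Res) if $P\xrightarrow{l}P'$ and $x,y\notin\mathrm{cn}(l)$ then $(\nu xy)P\xrightarrow{l}(\nu xy)P'$. (Communication) $(\nu xy)P\xrightarrow{\tau}R$ whenever $P\xrightarrow{m}P'$ and: $m=x[]\parallel y()$, $R=P'$; $m=x[x']\parallel y(y')$, $R=(\nu xy)(\nu x'y')P'$; $m=x[\mathsf{inl}]\parallel y(\mathsf{inl})$ or $m=x[\mathsf{inr}]\parallel y(\mathsf{inr})$ or $m=x[A]\parallel y(A)$ or $m={?}x[]\parallel{!}y()$, $R=(\nu xy)P'$; $m={?}x[x']\parallel{!}y(y')$, $R=(\nu x'y')P'$; $m={?}x[x_1,x_2]\parallel{!}y(y_1,y_2)$, $R=(\nu x_1y_1)P'$; $m=z\leftrightarrow y$ with $z\notin\{x,y\}$, $R=P'\{z/x\}$. **Derivation transitions.** Each typing rule introduces exactly one process constructor, so write derivations with the same constructors, each denoting the application of the corresponding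 typing rule to subderivations (e.g. $(\nu xy)D$ ends with Cut applied to $D$; $x\leftrightarrow y$ is an instance of Ax; $\mathbf 0$ is Mix$_0$). The transition relation on derivations is the least one closed under all the rules above read on derivations (process metavariables replaced by derivations, all displayed derivations being valid, substitutions applied throughout a derivation, $\mathrm{fn}(D)=\mathrm{fn}(\mathrm{proc}(D))$); rule ($\alpha$) reads: a derivation of $\vdash P::\mathcal G$ has every transition of any derivation of $\vdash Q::\mathcal G$ with $P=_\alpha Q$. In (Res) the premise goes from a derivation with hyperenvironment $\mathcal G\parallel\Gamma,x:A\parallel\Delta,y:A^\perp$ to one with $\mathcal G'\parallel\Gamma',x:A\parallel\Delta',y:A^\perp$. In (Communication) the premise goes from hyperenvironment $\mathcal G\parallel\Gamma,x:C\parallel\Delta,y:C^\perp$ to: $\mathcal G\parallel\Delta$ for $C=1$ ($\Gamma$ empty); $\mathcal G\parallel\Gamma_1,x:B\parallel\Gamma_2,x':A\parallel\Delta,y:B^\perp,y':A^\perp$ for $C=A\otimes B$, $\Gamma=\Gamma_1,\Gamma_2$; $\mathcal G\parallel\Gamma,x:A_i\parallel\Delta,y:A_i^\perp$ for $C=A_1\oplus A_2$ ($i=1$ for $\mathsf{inl}$, $2$ for $\mathsf{inr}$); $\mathcal G\parallel\Gamma,x:B\{A/X\}\parallel\Delta,y:B^\perp\{A/X\}$ for $C=\exists X.B$; and for $C={?}A$: $\mathcal G\parallel\Gamma,x':A\parallel\Delta,y':A^\perp$ (use), $\mathcal G\parallel\Gamma,x_1:{?}A\wp{?}A\parallel\Delta,y_1:{!}A^\perp\otimes{!}A^\perp$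 (duplication), $\mathcal G\parallel\Gamma,x:\bot\parallel\Delta,y:1$ (disposal), where in the last two $\Delta$ has the form ${?}\Delta'$. For a link, the premise goes from $\mathcal G\parallel z:A^\perp,y:A\parallel\Gamma,x:A^\perp$ to $\mathcal G\parallel\Gamma,x:A^\perp$.
   Formalization: Literally (ii) fails, so: (Syn) also requires each label's bound names not free in the other component; !x(x1,x2) requires σ1, σ2 injective, x1, x2 distinct and fresh, no capture among the zi; duplication and disposal on derivations do not require Δ to be of the form ?Δ'. -}

module Defs where

open import Data.Empty using (⊥-elim)
open import Data.Fin.Base using (Fin; zero; suc; lift)
open import Data.List.Base using (List; []; _∷_; [_]; _++_; map; concat; filter; foldr)
open import Data.List.Membership.Propositional using (_∈_; _∉_)
open import Data.List.Membership.Propositional.Properties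
  using (∈-++⁺ˡ; ∈-++⁺ʳ; ∈-++⁻; ∈-map⁺; ∈-map⁻; ∈-filter⁺; ∈-filter⁻)
open import Data.List.Properties
  using (map-++; ++-assoc; ++-identityʳ; map-∘; map-cong; concat-map; concat-++)
open import Data.List.Relation.Binary.Disjoint.Propositional using (Disjoint)
open import Data.List.Relation.Binary.Permutation.Homogeneous as Perm using (Permutation)
open import Data.List.Relation.Binary.Permutation.Propositional as ↭ using (_↭_; ↭-sym; ↭-trans; ↭-refl; ↭-reflexive)
open import Data.List.Relation.Binary.Permutation.Propositional.Properties
  using (map⁺; ++⁺; ++⁺ˡ; ++⁺ʳ; ++-comm; shift; shifts; ∈-resp-↭)
open import Data.List.Relation.Binary.Pointwise as PW using (Pointwise; []; _∷_)
import Data.List.Relation.Binary.Permutation.Setoid.Properties as SetoidPermProps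
open import Data.List.Relation.Unary.All as All using (All; []; _∷_)
import Data.List.Relation.Unary.All.Properties as AllP
open import Data.List.Relation.Unary.AllPairs using ([]; _∷_)
open import Data.List.Relation.Unary.Any using (here; there)
open import Data.List.Relation.Unary.Unique.Propositional using (Unique)
import Data.List.Relation.Unary.Unique.Propositional.Properties as UniqueP
open import Data.Nat.Base using (ℕ; zero; suc)
open import Data.Product.Base using (∃; _×_; _,_; proj₁; proj₂; map₁; map₂)
open import Data.Sum.Base using (_⊎_; inj₁; inj₂)
open import Function.Base using (_∘_; id)
open import Function.Bundles using (_⇔_)
open import Relation.Binary.Definitions using (DecidableEquality)
open import Relation.Binary.PropositionalEquality
  using (_≡_; _≢_; refl; sym; trans; cong; cong₂; subst; setoid)
open import Relation.Nullary using (yes; no)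
open import Relation.Nullary.Decidable using (¬?)

record Names : Set₁ where
  field
    Name  : Set
    _≟_   : DecidableEquality Name
    fresh : (xs : List Name) → ∃ λ x → x ∉ xs

-- `Ty n` has its free type variables among `Fin n`; quantifiers bind de
-- Bruijn index zero, so that α-equivalent types are equal.

infixr 7 _⊗_ _⅋_
infixr 6 _⊕_ _&_
infix  8 ‵∃_ ‵∀_ ？_ ！_

data Ty (n : ℕ) : Set where
  _⊗_ _⅋_ _⊕_ _&_ : Ty n → Ty n → Ty n
  𝟏 ⊥̇             : Ty n
  var var⊥         : Fin n → Ty n
  ‵∃_ ‵∀_          : Ty (suc n) → Ty n
  ？_ ！_           : Ty n → Ty n

dual : ∀ {n} → Ty n → Ty n
dual (A ⊗ B)  = dual A ⅋ dual B
dual (A ⅋ B)  = dual A ⊗ dual B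
dual (A ⊕ B)  = dual A & dual B
dual (A & B)  = dual A ⊕ dual B
dual 𝟏        = ⊥̇
dual ⊥̇        = 𝟏
dual (var i)  = var⊥ i
dual (var⊥ i) = var i
dual (‵∃ A)   = ‵∀ dual A
dual (‵∀ A)   = ‵∃ dual A
dual (？ A)    = ！ dual A
dual (！ A)    = ？ dual A

ren : ∀ {m n} → (Fin m → Fin n) → Ty m → Ty n
ren ρ (A ⊗ B)  = ren ρ A ⊗ ren ρ B
ren ρ (A ⅋ B)  = ren ρ A ⅋ ren ρ B
ren ρ (A ⊕ B)  = ren ρ A ⊕ ren ρ B
ren ρ (A & B)  = ren ρ A & ren ρ B
ren ρ 𝟏        = 𝟏
ren ρ ⊥̇        = ⊥̇
ren ρ (var i)  = var (ρ i)
ren ρ (var⊥ i) = var⊥ (ρ i)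
ren ρ (‵∃ A)   = ‵∃ ren (lift 1 ρ) A
ren ρ (‵∀ A)   = ‵∀ ren (lift 1 ρ) A
ren ρ (？ A)    = ？ ren ρ A
ren ρ (！ A)    = ！ ren ρ A

wk : ∀ {n} → Ty n → Ty (suc n)
wk = ren suc

exts : ∀ {m n} → (Fin m → Ty n) → Fin (suc m) → Ty (suc n)
exts σ zero    = var zero
exts σ (suc i) = wk (σ i)

sub : ∀ {m n} → (Fin m → Ty n) → Ty m → Ty n
sub σ (A ⊗ B)  = sub σ A ⊗ sub σ B
sub σ (A ⅋ B)  = sub σ A ⅋ sub σ B
sub σ (A ⊕ B)  = sub σ A ⊕ sub σ B
sub σ (A & B)  = sub σ A & sub σ B
sub σ 𝟏        = 𝟏
sub σ ⊥̇        = ⊥̇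
sub σ (var i)  = σ i
sub σ (var⊥ i) = dual (σ i)
sub σ (‵∃ A)   = ‵∃ sub (exts σ) A
sub σ (‵∀ A)   = ‵∀ sub (exts σ) A
sub σ (？ A)    = ？ sub σ A
sub σ (！ A)    = ！ sub σ A

inst : ∀ {n} → Ty n → Fin (suc n) → Ty n
inst A zero    = A
inst A (suc i) = var i

infix 9 _[_]ᵗ

_[_]ᵗ : ∀ {n} → Ty (suc n) → Ty n → Ty n
B [ A ]ᵗ = sub (inst A) B

dual-involutive : ∀ {n} (A : Ty n) → dual (dual A) ≡ A
dual-involutive (A ⊗ B)  = cong₂ _⊗_ (dual-involutive A) (dual-involutive B)
dual-involutive (A ⅋ B)  = cong₂ _⅋_ (dual-involutive A) (dual-involutive B)
dual-involutive (A ⊕ B)  = cong₂ _⊕_ (dual-involutive A) (dual-involutive B)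
dual-involutive (A & B)  = cong₂ _&_ (dual-involutive A) (dual-involutive B)
dual-involutive 𝟏        = refl
dual-involutive ⊥̇        = refl
dual-involutive (var i)  = refl
dual-involutive (var⊥ i) = refl
dual-involutive (‵∃ A)   = cong ‵∃_ (dual-involutive A)
dual-involutive (‵∀ A)   = cong ‵∀_ (dual-involutive A)
dual-involutive (？ A)    = cong ？_ (dual-involutive A)
dual-involutive (！ A)    = cong ！_ (dual-involutive A)

ren-dual : ∀ {m n} (ρ : Fin m → Fin n) A → ren ρ (dual A) ≡ dual (ren ρ A)
ren-dual ρ (A ⊗ B)  = cong₂ _⅋_ (ren-dual ρ A) (ren-dual ρ B)
ren-dual ρ (A ⅋ B)  = cong₂ _⊗_ (ren-dual ρ A) (ren-dual ρ B)
ren-dual ρ (A ⊕ B)  = cong₂ _&_ (ren-dual ρ A) (ren-dual ρ B)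
ren-dual ρ (A & B)  = cong₂ _⊕_ (ren-dual ρ A) (ren-dual ρ B)
ren-dual ρ 𝟏        = refl
ren-dual ρ ⊥̇        = refl
ren-dual ρ (var i)  = refl
ren-dual ρ (var⊥ i) = refl
ren-dual ρ (‵∃ A)   = cong ‵∀_ (ren-dual (lift 1 ρ) A)
ren-dual ρ (‵∀ A)   = cong ‵∃_ (ren-dual (lift 1 ρ) A)
ren-dual ρ (？ A)    = cong ！_ (ren-dual ρ A)
ren-dual ρ (！ A)    = cong ？_ (ren-dual ρ A)

sub-dual : ∀ {m n} (σ : Fin m → Ty n) A → sub σ (dual A) ≡ dual (sub σ A)
sub-dual σ (A ⊗ B)  = cong₂ _⅋_ (sub-dual σ A) (sub-dual σ B)
sub-dual σ (A ⅋ B)  = cong₂ _⊗_ (sub-dual σ A) (sub-dual σ B)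
sub-dual σ (A ⊕ B)  = cong₂ _&_ (sub-dual σ A) (sub-dual σ B)
sub-dual σ (A & B)  = cong₂ _⊕_ (sub-dual σ A) (sub-dual σ B)
sub-dual σ 𝟏        = refl
sub-dual σ ⊥̇        = refl
sub-dual σ (var i)  = refl
sub-dual σ (var⊥ i) = sym (dual-involutive (σ i))
sub-dual σ (‵∃ A)   = cong ‵∀_ (sub-dual (exts σ) A)
sub-dual σ (‵∀ A)   = cong ‵∃_ (sub-dual (exts σ) A)
sub-dual σ (？ A)    = cong ！_ (sub-dual σ A)
sub-dual σ (！ A)    = cong ？_ (sub-dual σ A)

sub-cong : ∀ {m n} {σ τ : Fin m → Ty n} → (∀ i → σ i ≡ τ i) → ∀ A → sub σ A ≡ sub τ A
sub-cong h (A ⊗ B)  = cong₂ _⊗_ (sub-cong h A) (sub-cong h B)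
sub-cong h (A ⅋ B)  = cong₂ _⅋_ (sub-cong h A) (sub-cong h B)
sub-cong h (A ⊕ B)  = cong₂ _⊕_ (sub-cong h A) (sub-cong h B)
sub-cong h (A & B)  = cong₂ _&_ (sub-cong h A) (sub-cong h B)
sub-cong h 𝟏        = refl
sub-cong h ⊥̇        = refl
sub-cong h (var i)  = h i
sub-cong h (var⊥ i) = cong dual (h i)
sub-cong h (‵∃ A)   = cong ‵∃_ (sub-cong (λ { zero → refl ; (suc i) → cong wk (h i) }) A)
sub-cong h (‵∀ A)   = cong ‵∀_ (sub-cong (λ { zero → refl ; (suc i) → cong wk (h i) }) A)
sub-cong h (？ A)    = cong ？_ (sub-cong h A)
sub-cong h (！ A)    = cong ！_ (sub-cong h A)

sub-ren : ∀ {l m n} {σ : Fin m → Ty n} {ρ : Fin l → Fin m} {τ : Fin l → Ty n} →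
          (∀ i → σ (ρ i) ≡ τ i) → ∀ A → sub σ (ren ρ A) ≡ sub τ A
sub-ren h (A ⊗ B)  = cong₂ _⊗_ (sub-ren h A) (sub-ren h B)
sub-ren h (A ⅋ B)  = cong₂ _⅋_ (sub-ren h A) (sub-ren h B)
sub-ren h (A ⊕ B)  = cong₂ _⊕_ (sub-ren h A) (sub-ren h B)
sub-ren h (A & B)  = cong₂ _&_ (sub-ren h A) (sub-ren h B)
sub-ren h 𝟏        = refl
sub-ren h ⊥̇        = refl
sub-ren h (var i)  = h i
sub-ren h (var⊥ i) = cong dual (h i)
sub-ren h (‵∃ A)   = cong ‵∃_ (sub-ren (λ { zero → refl ; (suc i) → cong wk (h i) }) A)
sub-ren h (‵∀ A)   = cong ‵∀_ (sub-ren (λ { zero → refl ; (suc i) → cong wk (h i) }) A)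
sub-ren h (？ A)    = cong ？_ (sub-ren h A)
sub-ren h (！ A)    = cong ！_ (sub-ren h A)

ren-ren : ∀ {l m n} {ρ : Fin m → Fin n} {ξ : Fin l → Fin m} {ζ : Fin l → Fin n} →
          (∀ i → ρ (ξ i) ≡ ζ i) → ∀ A → ren ρ (ren ξ A) ≡ ren ζ A
ren-ren h (A ⊗ B)  = cong₂ _⊗_ (ren-ren h A) (ren-ren h B)
ren-ren h (A ⅋ B)  = cong₂ _⅋_ (ren-ren h A) (ren-ren h B)
ren-ren h (A ⊕ B)  = cong₂ _⊕_ (ren-ren h A) (ren-ren h B)
ren-ren h (A & B)  = cong₂ _&_ (ren-ren h A) (ren-ren h B)
ren-ren h 𝟏        = refl
ren-ren h ⊥̇        = refl
ren-ren h (var i)  = cong var (h i)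
ren-ren h (var⊥ i) = cong var⊥ (h i)
ren-ren h (‵∃ A)   = cong ‵∃_ (ren-ren (λ { zero → refl ; (suc i) → cong suc (h i) }) A)
ren-ren h (‵∀ A)   = cong ‵∀_ (ren-ren (λ { zero → refl ; (suc i) → cong suc (h i) }) A)
ren-ren h (？ A)    = cong ？_ (ren-ren h A)
ren-ren h (！ A)    = cong ！_ (ren-ren h A)

wk-ren : ∀ {m n} (ρ : Fin m → Fin n) A → ren (lift 1 ρ) (wk A) ≡ wk (ren ρ A)
wk-ren ρ A = trans (ren-ren (λ _ → refl) A) (sym (ren-ren (λ _ → refl) A))

ren-sub : ∀ {l m n} {ρ : Fin m → Fin n} {σ : Fin l → Ty m} {τ : Fin l → Ty n} →
          (∀ i → ren ρ (σ i) ≡ τ i) → ∀ A → ren ρ (sub σ A) ≡ sub τ A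
ren-sub h (A ⊗ B)  = cong₂ _⊗_ (ren-sub h A) (ren-sub h B)
ren-sub h (A ⅋ B)  = cong₂ _⅋_ (ren-sub h A) (ren-sub h B)
ren-sub h (A ⊕ B)  = cong₂ _⊕_ (ren-sub h A) (ren-sub h B)
ren-sub h (A & B)  = cong₂ _&_ (ren-sub h A) (ren-sub h B)
ren-sub h 𝟏        = refl
ren-sub h ⊥̇        = refl
ren-sub h (var i)  = h i
ren-sub {ρ = ρ} {σ} h (var⊥ i) = trans (ren-dual ρ (σ i)) (cong dual (h i))
ren-sub {ρ = ρ} {σ} h (‵∃ A)   =
  cong ‵∃_ (ren-sub (λ { zero → refl ; (suc i) → trans (wk-ren ρ (σ i)) (cong wk (h i)) }) A)
ren-sub {ρ = ρ} {σ} h (‵∀ A)   =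
  cong ‵∀_ (ren-sub (λ { zero → refl ; (suc i) → trans (wk-ren ρ (σ i)) (cong wk (h i)) }) A)
ren-sub h (？ A)    = cong ？_ (ren-sub h A)
ren-sub h (！ A)    = cong ！_ (ren-sub h A)

wk-sub : ∀ {m n} (σ : Fin m → Ty n) A → sub (exts σ) (wk A) ≡ wk (sub σ A)
wk-sub σ A = trans (sub-ren (λ _ → refl) A) (sym (ren-sub (λ _ → refl) A))

sub-sub : ∀ {l m n} {σ : Fin m → Ty n} {τ : Fin l → Ty m} {υ : Fin l → Ty n} →
          (∀ i → sub σ (τ i) ≡ υ i) → ∀ A → sub σ (sub τ A) ≡ sub υ A
sub-sub h (A ⊗ B)  = cong₂ _⊗_ (sub-sub h A) (sub-sub h B)
sub-sub h (A ⅋ B)  = cong₂ _⅋_ (sub-sub h A) (sub-sub h B)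
sub-sub h (A ⊕ B)  = cong₂ _⊕_ (sub-sub h A) (sub-sub h B)
sub-sub h (A & B)  = cong₂ _&_ (sub-sub h A) (sub-sub h B)
sub-sub h 𝟏        = refl
sub-sub h ⊥̇        = refl
sub-sub h (var i)  = h i
sub-sub {σ = σ} {τ} h (var⊥ i) = trans (sub-dual σ (τ i)) (cong dual (h i))
sub-sub {σ = σ} {τ} h (‵∃ A)   =
  cong ‵∃_ (sub-sub (λ { zero → refl ; (suc i) → trans (wk-sub σ (τ i)) (cong wk (h i)) }) A)
sub-sub {σ = σ} {τ} h (‵∀ A)   =
  cong ‵∀_ (sub-sub (λ { zero → refl ; (suc i) → trans (wk-sub σ (τ i)) (cong wk (h i)) }) A)
sub-sub h (？ A)    = cong ？_ (sub-sub h A)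
sub-sub h (！ A)    = cong ！_ (sub-sub h A)

sub-var : ∀ {n} {σ : Fin n → Ty n} → (∀ i → σ i ≡ var i) → ∀ A → sub σ A ≡ A
sub-var h (A ⊗ B)  = cong₂ _⊗_ (sub-var h A) (sub-var h B)
sub-var h (A ⅋ B)  = cong₂ _⅋_ (sub-var h A) (sub-var h B)
sub-var h (A ⊕ B)  = cong₂ _⊕_ (sub-var h A) (sub-var h B)
sub-var h (A & B)  = cong₂ _&_ (sub-var h A) (sub-var h B)
sub-var h 𝟏        = refl
sub-var h ⊥̇        = refl
sub-var h (var i)  = h i
sub-var h (var⊥ i) = cong dual (h i)
sub-var h (‵∃ A)   = cong ‵∃_ (sub-var (λ { zero → refl ; (suc i) → cong wk (h i) }) A)
sub-var h (‵∀ A)   = cong ‵∀_ (sub-var (λ { zero → refl ; (suc i) → cong wk (h i) }) A)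
sub-var h (？ A)    = cong ？_ (sub-var h A)
sub-var h (！ A)    = cong ！_ (sub-var h A)

inst-wk : ∀ {n} (A B : Ty n) → sub (inst B) (wk A) ≡ A
inst-wk A B = trans (sub-ren (λ _ → refl) A) (sub-var (λ _ → refl) A)

sub-inst : ∀ {m n} (σ : Fin m → Ty n) B A → sub σ (B [ A ]ᵗ) ≡ (sub (exts σ) B) [ sub σ A ]ᵗ
sub-inst σ B A =
  trans (sub-sub (λ _ → refl) B)
        (sym (sub-sub (λ { zero → refl ; (suc i) → inst-wk (σ i) (sub σ A) }) B))

module πLL (N : Names) where
  open Names N

  infixr 4 _∥_

  -- In `inpT x P` the continuation binds type variable zero.
  data Proc (n : ℕ) : Set where
    out   : Name → Name → Proc n → Proc n         -- x[y].P
    inp   : Name → Name → Proc n → Proc n         -- x(y).P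
    close : Name → Proc n → Proc n                -- x[].P
    wait  : Name → Proc n → Proc n                -- x().P
    inl   : Name → Proc n → Proc n                -- x[inl].P
    inr   : Name → Proc n → Proc n                -- x[inr].P
    case  : Name → Proc n → Proc n → Proc n       -- x ▷ (P , Q)
    outT  : Name → Ty n → Proc n → Proc n         -- x[A].P
    inpT  : Name → Proc (suc n) → Proc n          -- x(X).P
    serve : Name → Name → Proc n → Proc n         -- !x(y).P
    use   : Name → Name → Proc n → Proc n         -- ?x[y].P
    dup   : Name → Name → Name → Proc n → Proc n  -- ?x[x₁,x₂].P
    drop  : Name → Proc n → Proc n                -- ?x[].P
    ν     : Name → Name → Proc n → Proc n         -- (ν x y) P
    _∥_   : Proc n → Proc n → Proc n
    𝟘     : Proc n
    link  : Name → Name → Proc n                  -- x ↔ y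

  infixl 5 _∖_

  _∖_ : List Name → Name → List Name
  xs ∖ y = filter (λ z → ¬? (z ≟ y)) xs

  fn : ∀ {n} → Proc n → List Name
  fn (out x y P)     = x ∷ (fn P ∖ y)
  fn (inp x y P)     = x ∷ (fn P ∖ y)
  fn (close x P)     = x ∷ fn P
  fn (wait x P)      = x ∷ fn P
  fn (inl x P)       = x ∷ fn P
  fn (inr x P)       = x ∷ fn P
  fn (case x P Q)    = x ∷ fn P ++ fn Q
  fn (outT x A P)    = x ∷ fn P
  fn (inpT x P)      = x ∷ fn P
  fn (serve x y P)   = x ∷ (fn P ∖ y)
  fn (use x y P)     = x ∷ (fn P ∖ y)
  fn (dup x x₁ x₂ P) = x ∷ (fn P ∖ x₂ ∖ x₁)
  fn (drop x P)      = x ∷ fn P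
  fn (ν x y P)       = fn P ∖ y ∖ x
  fn (P ∥ Q)         = fn P ++ fn Q
  fn 𝟘               = []
  fn (link x y)      = x ∷ y ∷ []

  subP : ∀ {m n} → (Fin m → Ty n) → Proc m → Proc n
  subP σ (out x y P)     = out x y (subP σ P)
  subP σ (inp x y P)     = inp x y (subP σ P)
  subP σ (close x P)     = close x (subP σ P)
  subP σ (wait x P)      = wait x (subP σ P)
  subP σ (inl x P)       = inl x (subP σ P)
  subP σ (inr x P)       = inr x (subP σ P)
  subP σ (case x P Q)    = case x (subP σ P) (subP σ Q)
  subP σ (outT x A P)    = outT x (sub σ A) (subP σ P)
  subP σ (inpT x P)      = inpT x (subP (exts σ) P)
  subP σ (serve x y P)   = serve x y (subP σ P)
  subP σ (use x y P)     = use x y (subP σ P)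
  subP σ (dup x x₁ x₂ P) = dup x x₁ x₂ (subP σ P)
  subP σ (drop x P)      = drop x (subP σ P)
  subP σ (ν x y P)       = ν x y (subP σ P)
  subP σ (P ∥ Q)         = subP σ P ∥ subP σ Q
  subP σ 𝟘               = 𝟘
  subP σ (link x y)      = link x y

  infix 9 _[_]ᵖ

  _[_]ᵖ : ∀ {n} → Proc (suc n) → Ty n → Proc n
  P [ A ]ᵖ = subP (inst A) P

  infixl 9 _[_↦_]

  _[_↦_] : (Name → Name) → Name → Name → Name → Name
  (ρ [ y ↦ z ]) a with a ≟ y
  ... | yes _ = z
  ... | no  _ = ρ a

  new : List Name → Name
  new xs = proj₁ (fresh xs)

  -- Capture-avoiding simultaneous substitution of names.  Every binder is
  -- replaced by a name outside the image of the free names below it.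
  infix 9 _⟨_⟩

  _⟨_⟩ : ∀ {n} → Proc n → (Name → Name) → Proc n
  out x y P     ⟨ ρ ⟩ = let y′ = new (map ρ (fn P)) in out (ρ x) y′ (P ⟨ ρ [ y ↦ y′ ] ⟩)
  inp x y P     ⟨ ρ ⟩ = let y′ = new (map ρ (fn P)) in inp (ρ x) y′ (P ⟨ ρ [ y ↦ y′ ] ⟩)
  close x P     ⟨ ρ ⟩ = close (ρ x) (P ⟨ ρ ⟩)
  wait x P      ⟨ ρ ⟩ = wait (ρ x) (P ⟨ ρ ⟩)
  inl x P       ⟨ ρ ⟩ = inl (ρ x) (P ⟨ ρ ⟩)
  inr x P       ⟨ ρ ⟩ = inr (ρ x) (P ⟨ ρ ⟩)
  case x P Q    ⟨ ρ ⟩ = case (ρ x) (P ⟨ ρ ⟩) (Q ⟨ ρ ⟩)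
  outT x A P    ⟨ ρ ⟩ = outT (ρ x) A (P ⟨ ρ ⟩)
  inpT x P      ⟨ ρ ⟩ = inpT (ρ x) (P ⟨ ρ ⟩)
  serve x y P   ⟨ ρ ⟩ = let y′ = new (map ρ (fn P)) in serve (ρ x) y′ (P ⟨ ρ [ y ↦ y′ ] ⟩)
  use x y P     ⟨ ρ ⟩ = let y′ = new (map ρ (fn P)) in use (ρ x) y′ (P ⟨ ρ [ y ↦ y′ ] ⟩)
  dup x x₁ x₂ P ⟨ ρ ⟩ =
    let x₁′ = new (map ρ (fn P)) ; x₂′ = new (x₁′ ∷ map ρ (fn P)) in
    dup (ρ x) x₁′ x₂′ (P ⟨ ρ [ x₁ ↦ x₁′ ] [ x₂ ↦ x₂′ ] ⟩)
  drop x P      ⟨ ρ ⟩ = drop (ρ x) (P ⟨ ρ ⟩)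
  ν x y P       ⟨ ρ ⟩ =
    let x′ = new (map ρ (fn P)) ; y′ = new (x′ ∷ map ρ (fn P)) in
    ν x′ y′ (P ⟨ ρ [ x ↦ x′ ] [ y ↦ y′ ] ⟩)
  (P ∥ Q)       ⟨ ρ ⟩ = (P ⟨ ρ ⟩) ∥ (Q ⟨ ρ ⟩)
  𝟘             ⟨ ρ ⟩ = 𝟘
  link x y      ⟨ ρ ⟩ = link (ρ x) (ρ y)

  transpose : Name → Name → Name → Name
  transpose a b c with c ≟ a
  ... | yes _ = b
  ... | no  _ with c ≟ b
  ...   | yes _ = a
  ...   | no  _ = c

  -- Exchanges a and b everywhere, at bound occurrences too.  When b is not
  -- free in P, (a b) · P is α-equivalent to P{b/a}.
  ⦅_↔_⦆·_ : ∀ {n} → Name → Name → Proc n → Proc n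
  ⦅ a ↔ b ⦆· out x y P     = out (transpose a b x) (transpose a b y) (⦅ a ↔ b ⦆· P)
  ⦅ a ↔ b ⦆· inp x y P     = inp (transpose a b x) (transpose a b y) (⦅ a ↔ b ⦆· P)
  ⦅ a ↔ b ⦆· close x P     = close (transpose a b x) (⦅ a ↔ b ⦆· P)
  ⦅ a ↔ b ⦆· wait x P      = wait (transpose a b x) (⦅ a ↔ b ⦆· P)
  ⦅ a ↔ b ⦆· inl x P       = inl (transpose a b x) (⦅ a ↔ b ⦆· P)
  ⦅ a ↔ b ⦆· inr x P       = inr (transpose a b x) (⦅ a ↔ b ⦆· P)
  ⦅ a ↔ b ⦆· case x P Q    = case (transpose a b x) (⦅ a ↔ b ⦆· P) (⦅ a ↔ b ⦆· Q)
  ⦅ a ↔ b ⦆· outT x A P    = outT (transpose a b x) A (⦅ a ↔ b ⦆· P)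
  ⦅ a ↔ b ⦆· inpT x P      = inpT (transpose a b x) (⦅ a ↔ b ⦆· P)
  ⦅ a ↔ b ⦆· serve x y P   = serve (transpose a b x) (transpose a b y) (⦅ a ↔ b ⦆· P)
  ⦅ a ↔ b ⦆· use x y P     = use (transpose a b x) (transpose a b y) (⦅ a ↔ b ⦆· P)
  ⦅ a ↔ b ⦆· dup x x₁ x₂ P =
    dup (transpose a b x) (transpose a b x₁) (transpose a b x₂) (⦅ a ↔ b ⦆· P)
  ⦅ a ↔ b ⦆· drop x P      = drop (transpose a b x) (⦅ a ↔ b ⦆· P)
  ⦅ a ↔ b ⦆· ν x y P       = ν (transpose a b x) (transpose a b y) (⦅ a ↔ b ⦆· P)
  ⦅ a ↔ b ⦆· (P ∥ Q)       = (⦅ a ↔ b ⦆· P) ∥ (⦅ a ↔ b ⦆· Q)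
  ⦅ a ↔ b ⦆· 𝟘             = 𝟘
  ⦅ a ↔ b ⦆· link x y      = link (transpose a b x) (transpose a b y)

  infix 3 _=α_

  private variable
    n                          : ℕ
    x y z w x′ y′ x₁ x₂ y₁ y₂ : Name
    P P′ Q Q′ R                : Proc n
    A B                        : Ty n

  -- The least congruence that renames bound names to names not free in their
  -- scope and, by ν-swap, identifies (ν x y) P with (ν y x) P.
  data _=α_ : ∀ {n} → Proc n → Proc n → Set where
    α-refl  : P =α P
    α-sym   : P =α Q → Q =α P
    α-trans : P =α Q → Q =α R → P =α R

    α-out   : w ∉ fn P → out x y P =α out x w (⦅ y ↔ w ⦆· P)
    α-inp   : w ∉ fn P → inp x y P =α inp x w (⦅ y ↔ w ⦆· P)
    α-serve : w ∉ fn P → serve x y P =α serve x w (⦅ y ↔ w ⦆· P)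
    α-use   : w ∉ fn P → use x y P =α use x w (⦅ y ↔ w ⦆· P)
    α-dup₁  : x₁ ≢ x₂ → w ≢ x₂ → w ∉ fn P → dup x x₁ x₂ P =α dup x w x₂ (⦅ x₁ ↔ w ⦆· P)
    α-dup₂  : x₁ ≢ x₂ → w ≢ x₁ → w ∉ fn P → dup x x₁ x₂ P =α dup x x₁ w (⦅ x₂ ↔ w ⦆· P)
    α-ν     : x ≢ y → w ≢ y → w ∉ fn P → ν x y P =α ν w y (⦅ x ↔ w ⦆· P)
    ν-swap  : ν x y P =α ν y x P

    out-cong   : P =α Q → out x y P =α out x y Q
    inp-cong   : P =α Q → inp x y P =α inp x y Q
    close-cong : P =α Q → close x P =α close x Q
    wait-cong  : P =α Q → wait x P =α wait x Q
    inl-cong   : P =α Q → inl x P =α inl x Q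
    inr-cong   : P =α Q → inr x P =α inr x Q
    case-cong  : P =α P′ → Q =α Q′ → case x P Q =α case x P′ Q′
    outT-cong  : P =α Q → outT x A P =α outT x A Q
    inpT-cong  : P =α Q → inpT x P =α inpT x Q
    serve-cong : P =α Q → serve x y P =α serve x y Q
    use-cong   : P =α Q → use x y P =α use x y Q
    dup-cong   : P =α Q → dup x x₁ x₂ P =α dup x x₁ x₂ Q
    drop-cong  : P =α Q → drop x P =α drop x Q
    ν-cong     : P =α Q → ν x y P =α ν x y Q
    ∥-cong     : P =α P′ → Q =α Q′ → P ∥ Q =α P′ ∥ Q′

  data Act (n : ℕ) : Set where
    close wait        : Name → Act n                -- x[]  x()
    out inp           : Name → Name → Act n         -- x[y]  x(y)
    inl coinl inr coinr : Name → Act n              -- x[inl]  x(inl)  x[inr]  x(inr)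
    use serve         : Name → Name → Act n         -- ?x[y]  !x(y)
    dup codup         : Name → Name → Name → Act n  -- ?x[x₁,x₂]  !x(x₁,x₂)
    drop codrop       : Name → Act n                -- ?x[]  !x()
    outT inpT         : Name → Ty n → Act n         -- x[A]  x(A)

  -- Pairs are unordered: both transition relations are closed under
  -- exchanging the components of a `pair` label.
  data Label (n : ℕ) : Set where
    τ    : Label n
    link : Name → Name → Label n
    act  : Act n → Label n
    pair : Act n → Act n → Label n

  fnᵃ : Act n → List Name
  fnᵃ (close x)       = [ x ]
  fnᵃ (wait x)        = [ x ]
  fnᵃ (out x y)       = [ x ]
  fnᵃ (inp x y)       = [ x ]
  fnᵃ (inl x)         = [ x ]
  fnᵃ (coinl x)       = [ x ]
  fnᵃ (inr x)         = [ x ]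
  fnᵃ (coinr x)       = [ x ]
  fnᵃ (use x y)       = [ x ]
  fnᵃ (serve x y)     = [ x ]
  fnᵃ (dup x x₁ x₂)   = [ x ]
  fnᵃ (codup x x₁ x₂) = [ x ]
  fnᵃ (drop x)        = [ x ]
  fnᵃ (codrop x)      = [ x ]
  fnᵃ (outT x A)      = [ x ]
  fnᵃ (inpT x A)      = [ x ]

  bnᵃ : Act n → List Name
  bnᵃ (out x y)       = [ y ]
  bnᵃ (inp x y)       = [ y ]
  bnᵃ (use x y)       = [ y ]
  bnᵃ (serve x y)     = [ y ]
  bnᵃ (dup x x₁ x₂)   = x₁ ∷ x₂ ∷ []
  bnᵃ (codup x x₁ x₂) = x₁ ∷ x₂ ∷ []
  bnᵃ (close x)       = []
  bnᵃ (wait x)        = []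
  bnᵃ (inl x)         = []
  bnᵃ (coinl x)       = []
  bnᵃ (inr x)         = []
  bnᵃ (coinr x)       = []
  bnᵃ (drop x)        = []
  bnᵃ (codrop x)      = []
  bnᵃ (outT x A)      = []
  bnᵃ (inpT x A)      = []

  fnˡ : Label n → List Name
  fnˡ τ          = []
  fnˡ (link x y) = x ∷ y ∷ []
  fnˡ (act a)    = fnᵃ a
  fnˡ (pair a b) = fnᵃ a ++ fnᵃ b

  bnˡ : Label n → List Name
  bnˡ τ          = []
  bnˡ (link x y) = []
  bnˡ (act a)    = bnᵃ a
  bnˡ (pair a b) = bnᵃ a ++ bnᵃ b

  cn : Label n → List Name
  cn l = fnˡ l ++ bnˡ l

  _Enumerates_ : List Name → List Name → Set
  zs Enumerates xs = Unique zs × (∀ z → z ∈ zs ⇔ z ∈ xs)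

  InjectiveOn : (Name → Name) → List Name → Set
  InjectiveOn ρ xs = ∀ {a b} → a ∈ xs → b ∈ xs → ρ a ≡ ρ b → a ≡ b

  drops : List Name → Proc n → Proc n
  drops zs Q = foldr drop Q zs

  dups : (σ₁ σ₂ : Name → Name) → List Name → Proc n → Proc n
  dups σ₁ σ₂ zs Q = foldr (λ z → dup z (σ₁ z) (σ₂ z)) Q zs

  -- Side condition of the duplication of !x(x′).P along the label !x(x₁,x₂).
  -- The fields after `apart` spell out Barendregt's convention: σ₁ and σ₂ are
  -- injective, the bound names x₁, x₂ of the label are fresh, and no prefix
  -- ?zᵢ[zᵢσ₁,zᵢσ₂] of the residual captures a zⱼ.
  record Copying (P : Proc n) (x′ : Name) (zs : List Name) (x₁ x₂ : Name)
                 (σ₁ σ₂ : Name → Name) : Set where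
    field
      enumerates  : zs Enumerates (fn P ∖ x′)
      apart       : Disjoint (fn (P ⟨ σ₁ ⟩)) (fn (P ⟨ σ₂ ⟩))
      injective₁  : InjectiveOn σ₁ (fn P)
      injective₂  : InjectiveOn σ₂ (fn P)
      x₁≢x₂       : x₁ ≢ x₂
      x₁-fresh    : x₁ ∉ zs ++ map σ₁ zs ++ map σ₂ zs
      x₂-fresh    : x₂ ∉ zs ++ map σ₁ zs ++ map σ₂ zs
      uncaptured₁ : ∀ {z w} → z ∈ zs → w ∈ zs → σ₁ z ≡ w → z ≡ w
      uncaptured₂ : ∀ {z w} → z ∈ zs → w ∈ zs → σ₂ z ≡ w → z ≡ w

  private variable
    a b   : Act n
    l     : Label n
    zs    : List Name
    σ₁ σ₂ : Name → Name

  infix 3 _—[_]→_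

  data _—[_]→_ {n : ℕ} : Proc n → Label n → Proc n → Set where
    out   : out x y P —[ act (out x y) ]→ P
    inp   : inp x y P —[ act (inp x y) ]→ P
    close : close x P —[ act (close x) ]→ P
    wait  : wait x P —[ act (wait x) ]→ P
    inl   : inl x P —[ act (inl x) ]→ P
    inr   : inr x P —[ act (inr x) ]→ P
    outT  : outT x A P —[ act (outT x A) ]→ P
    use   : use x y P —[ act (use x y) ]→ P
    serve : serve x y P —[ act (serve x y) ]→ P

    coinl : case x P Q —[ act (coinl x) ]→ P
    coinr : case x P Q —[ act (coinr x) ]→ Q
    inpT  : inpT x P —[ act (inpT x A) ]→ P [ A ]ᵖ
    drop  : drop x P —[ act (drop x) ]→ wait x P
    dup   : dup x x₁ x₂ P —[ act (dup x x₁ x₂) ]→ inp x₁ x₂ P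

    codrop : zs Enumerates (fn P ∖ x′) →
             serve x x′ P —[ act (codrop x) ]→ drops zs (close x 𝟘)
    codup  : Copying P x′ zs x₁ x₂ σ₁ σ₂ →
             serve x x′ P —[ act (codup x x₁ x₂) ]→
               dups σ₁ σ₂ zs (out x₁ x₂ (serve x₁ (σ₁ x′) (P ⟨ σ₁ ⟩) ∥ serve x₂ (σ₂ x′) (P ⟨ σ₂ ⟩)))

    link₁ : link x y —[ link x y ]→ 𝟘
    link₂ : link x y —[ link y x ]→ 𝟘

    alpha : P =α Q → Q —[ l ]→ R → P —[ l ]→ R

    parˡ  : P —[ l ]→ P′ → Disjoint (bnˡ l) (fn Q) → P ∥ Q —[ l ]→ P′ ∥ Q
    parʳ  : Q —[ l ]→ Q′ → Disjoint (bnˡ l) (fn P) → P ∥ Q —[ l ]→ P ∥ Q′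

    -- As in parˡ and parʳ, the bound names of each label are fresh for the
    -- other component; otherwise x[x′] could capture a free x′ of Q.
    syn   : P —[ act a ]→ P′ → Q —[ act b ]→ Q′ → Disjoint (bnᵃ a) (bnᵃ b) →
            Disjoint (bnᵃ a) (fn Q) → Disjoint (bnᵃ b) (fn P) →
            P ∥ Q —[ pair a b ]→ P′ ∥ Q′
    flip  : P —[ pair a b ]→ P′ → P —[ pair b a ]→ P′

    res   : P —[ l ]→ P′ → x ∉ cn l → y ∉ cn l → ν x y P —[ l ]→ ν x y P′

    τ-close : P —[ pair (close x) (wait y) ]→ P′ → ν x y P —[ τ ]→ P′
    τ-out   : P —[ pair (out x x′) (inp y y′) ]→ P′ → ν x y P —[ τ ]→ ν x y (ν x′ y′ P′)
    τ-inl   : P —[ pair (inl x) (coinl y) ]→ P′ → ν x y P —[ τ ]→ ν x y P′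
    τ-inr   : P —[ pair (inr x) (coinr y) ]→ P′ → ν x y P —[ τ ]→ ν x y P′
    τ-outT  : P —[ pair (outT x A) (inpT y A) ]→ P′ → ν x y P —[ τ ]→ ν x y P′
    τ-drop  : P —[ pair (drop x) (codrop y) ]→ P′ → ν x y P —[ τ ]→ ν x y P′
    τ-use   : P —[ pair (use x x′) (serve y y′) ]→ P′ → ν x y P —[ τ ]→ ν x′ y′ P′
    τ-dup   : P —[ pair (dup x x₁ x₂) (codup y y₁ y₂) ]→ P′ → ν x y P —[ τ ]→ ν x₁ y₁ P′
    τ-link  : P —[ link z y ]→ P′ → z ≢ x → z ≢ y → ν x y P —[ τ ]→ P′ ⟨ id [ x ↦ z ] ⟩

  Env HEnv : ℕ → Set
  Env n  = List (Name × Ty n)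
  HEnv n = List (Env n)

  -- Hyperenvironments are multisets of unordered environments: `≋` permutes
  -- the environments and the entries inside each of them.
  infix 4 _≋_

  _≋_ : HEnv n → HEnv n → Set
  _≋_ = Permutation _↭_

  dom : Env n → List Name
  dom = map proj₁

  names : HEnv n → List Name
  names 𝒢 = dom (concat 𝒢)

  ？ᵉ : Env n → Env n
  ？ᵉ = map (map₂ ？_)

  wkᵉ : Env n → Env (suc n)
  wkᵉ = map (map₂ wk)

  private variable
    Γ Γ′ Γ₁ Γ₂ Δ Δ′ Θ  : Env n
    𝒢 𝒢′ ℋ ℋ′          : HEnv n

  -- The principal environment or entry is displayed first.  The freshness
  -- premises are those needed for all names of a conclusion to be distinct
  -- (see `distinct`).  `exch` only changes the list that represents a
  -- hyperenvironment and introduces no process constructor.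
  infix 3 _⊢_

  data _⊢_ : ∀ {n} → Proc n → HEnv n → Set where
    ax     : x ≢ y → link x y ⊢ [ (x , dual A) ∷ (y , A) ∷ [] ]
    cut    : P ⊢ ((x , A) ∷ Γ) ∷ ((y , dual A) ∷ Δ) ∷ 𝒢 → ν x y P ⊢ (Γ ++ Δ) ∷ 𝒢
    mix    : P ⊢ 𝒢 → Q ⊢ ℋ → Disjoint (names 𝒢) (names ℋ) → P ∥ Q ⊢ 𝒢 ++ ℋ
    mix₀   : ∀ {n} → 𝟘 {n} ⊢ []
    tensor : P ⊢ ((y , A) ∷ Γ) ∷ ((x , B) ∷ Δ) ∷ [] → out x y P ⊢ [ (x , A ⊗ B) ∷ Γ ++ Δ ]
    one    : P ⊢ [] → close x P ⊢ [ [ (x , 𝟏) ] ]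
    par    : P ⊢ [ (y , A) ∷ (x , B) ∷ Γ ] → inp x y P ⊢ [ (x , A ⅋ B) ∷ Γ ]
    bot    : P ⊢ [ Γ ] → x ∉ dom Γ → wait x P ⊢ [ (x , ⊥̇) ∷ Γ ]
    plus₁  : P ⊢ [ (x , A) ∷ Γ ] → inl x P ⊢ [ (x , A ⊕ B) ∷ Γ ]
    plus₂  : P ⊢ [ (x , B) ∷ Γ ] → inr x P ⊢ [ (x , A ⊕ B) ∷ Γ ]
    with&  : P ⊢ [ (x , A) ∷ Γ ] → Q ⊢ [ (x , B) ∷ Γ ] → case x P Q ⊢ [ (x , A & B) ∷ Γ ]
    bang   : P ⊢ [ (y , A) ∷ ？ᵉ Γ ] → x ∉ dom Γ → serve x y P ⊢ [ (x , ！ A) ∷ ？ᵉ Γ ]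
    quest  : P ⊢ [ (y , A) ∷ Γ ] → x ∉ dom Γ → use x y P ⊢ [ (x , ？ A) ∷ Γ ]
    weak   : P ⊢ [ Γ ] → x ∉ dom Γ → drop x P ⊢ [ (x , ？ A) ∷ Γ ]
    contr  : P ⊢ [ (x₁ , ？ A) ∷ (x₂ , ？ A) ∷ Γ ] → x ∉ dom Γ → dup x x₁ x₂ P ⊢ [ (x , ？ A) ∷ Γ ]
    ex     : P ⊢ [ (x , B [ A ]ᵗ) ∷ Γ ] → outT x A P ⊢ [ (x , ‵∃ B) ∷ Γ ]
    all    : P ⊢ [ (x , B) ∷ wkᵉ Γ ] → inpT x P ⊢ [ (x , ‵∀ B) ∷ Γ ]
    exch   : 𝒢 ≋ ℋ → P ⊢ 𝒢 → P ⊢ ℋ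

  ∈-∖⁺ : ∀ {xs} → z ∈ xs → z ≢ y → z ∈ xs ∖ y
  ∈-∖⁺ {y = y} = ∈-filter⁺ (λ z → ¬? (z ≟ y))

  ∈-∖⁻ : ∀ xs → z ∈ xs ∖ y → z ∈ xs × z ≢ y
  ∈-∖⁻ {y = y} _ = ∈-filter⁻ (λ z → ¬? (z ≟ y))

  ∈⇒≢ : ∀ {xs} → z ∈ xs → y ∉ xs → z ≢ y
  ∈⇒≢ z∈ y∉ refl = y∉ z∈

  names-[] : (Γ : Env n) → names [ Γ ] ≡ dom Γ
  names-[] Γ = cong dom (++-identityʳ Γ)

  names-++ : (𝒢 ℋ : HEnv n) → names (𝒢 ++ ℋ) ≡ names 𝒢 ++ names ℋ
  names-++ 𝒢 ℋ = trans (cong dom (sym (concat-++ 𝒢 ℋ))) (map-++ proj₁ (concat 𝒢) (concat ℋ))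

  dom-map₂ : ∀ {m n} (f : Ty m → Ty n) (Γ : Env m) → dom (map (map₂ f) Γ) ≡ dom Γ
  dom-map₂ f Γ = sym (map-∘ Γ)

  ↭-concat : 𝒢 ≋ ℋ → concat 𝒢 ↭ concat ℋ
  ↭-concat (Perm.refl ps) = go ps
    where
    go : ∀ {𝒢 ℋ : HEnv n} → Pointwise _↭_ 𝒢 ℋ → concat 𝒢 ↭ concat ℋ
    go []       = ↭-refl
    go (p ∷ ps) = ++⁺ p (go ps)
  ↭-concat (Perm.prep p e)   = ++⁺ p (↭-concat e)
  ↭-concat (Perm.swap {x′ = Γ} {y′ = Δ} p q e) =
    ↭-trans (++⁺ p (++⁺ q (↭-concat e))) (shifts Γ Δ)
  ↭-concat (Perm.trans e e′) = ↭-trans (↭-concat e) (↭-concat e′)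

  ↭-names : 𝒢 ≋ ℋ → names 𝒢 ↭ names ℋ
  ↭-names e = map⁺ proj₁ (↭-concat e)

  Unique-↭ : ∀ {xs ys : List Name} → xs ↭ ys → Unique xs → Unique ys
  Unique-↭ p = SetoidPermProps.Unique-resp-↭ (setoid Name) (↭.↭⇒↭ₛ p)

  merge-↭ : ∀ {X : Set} (p q : X) Γ Δ Θ → (p ∷ Γ) ++ (q ∷ Δ) ++ Θ ↭ p ∷ q ∷ (Γ ++ Δ) ++ Θ
  merge-↭ p q Γ Δ Θ =
    ↭.prep p (↭-trans (shift q Γ (Δ ++ Θ)) (↭.prep q (↭-reflexive (sym (++-assoc Γ Δ Θ)))))

  head∉ : ∀ {xs} → Unique (x ∷ xs) → x ∉ xs
  head∉ (p ∷ _) = AllP.All¬⇒¬Any p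

  tail! : ∀ {xs : List Name} → Unique (x ∷ xs) → Unique xs
  tail! (_ ∷ u) = u

  _∷!_ : ∀ {xs} → x ∉ xs → Unique xs → Unique (x ∷ xs)
  x∉ ∷! u = AllP.¬Any⇒All¬ _ x∉ ∷ u

  ∉-[] : (Γ : Env n) → x ∉ dom Γ → x ∉ names [ Γ ]
  ∉-[] Γ = subst (_ ∉_) (sym (names-[] Γ))

  ∉-map₂ : ∀ {m n} {f : Ty m → Ty n} (Γ : Env m) → x ∉ dom Γ → x ∉ dom (map (map₂ f) Γ)
  ∉-map₂ {f = f} Γ = subst (_ ∉_) (sym (dom-map₂ f Γ))

  names-map₂ : ∀ {m n} (f : Ty m → Ty n) (Γ : Env m) → names [ map (map₂ f) Γ ] ≡ names [ Γ ]
  names-map₂ f Γ = trans (names-[] (map (map₂ f) Γ)) (trans (dom-map₂ f Γ) (sym (names-[] Γ)))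

  distinct : P ⊢ 𝒢 → Unique (names 𝒢)
  distinct (ax x≢y) = (x≢y ∷ []) ∷ [] ∷ []
  distinct (cut {x = x} {A = A} {Γ = Γ} {y = y} {Δ = Δ} {𝒢 = 𝒢} D) =
    tail! (tail! (Unique-↭ (map⁺ proj₁ (merge-↭ (x , A) (y , dual A) Γ Δ (concat 𝒢))) (distinct D)))
  distinct (mix {𝒢 = 𝒢} {ℋ = ℋ} D E d) =
    subst Unique (sym (names-++ 𝒢 ℋ)) (UniqueP.++⁺ (distinct D) (distinct E) d)
  distinct mix₀ = []
  distinct (tensor {y = y} {A = A} {Γ = Γ} {x = x} {B = B} {Δ = Δ} D) =
    tail! (Unique-↭ (map⁺ proj₁ (merge-↭ (y , A) (x , B) Γ Δ [])) (distinct D))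
  distinct (one D) = [] ∷ []
  distinct (par D) = tail! (distinct D)
  distinct (bot {Γ = Γ} D x∉) = ∉-[] Γ x∉ ∷! distinct D
  distinct (plus₁ D) = distinct D
  distinct (plus₂ D) = distinct D
  distinct (with& D E) = distinct D
  distinct (bang {Γ = Γ} D x∉) = ∉-[] (？ᵉ Γ) (∉-map₂ Γ x∉) ∷! tail! (distinct D)
  distinct (quest {Γ = Γ} D x∉) = ∉-[] Γ x∉ ∷! tail! (distinct D)
  distinct (weak {Γ = Γ} D x∉) = ∉-[] Γ x∉ ∷! distinct D
  distinct (contr {Γ = Γ} D x∉) = ∉-[] Γ x∉ ∷! tail! (tail! (distinct D))
  distinct (ex D) = distinct D
  distinct (all {x = x} {Γ = Γ} D) = subst (λ xs → Unique (x ∷ xs)) (names-map₂ wk Γ) (distinct D)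
  distinct (exch e D) = Unique-↭ (↭-names e) (distinct D)

  names⊆fn : P ⊢ 𝒢 → ∀ {z} → z ∈ names 𝒢 → z ∈ fn P
  names⊆fn (ax _) (here p) = here p
  names⊆fn (ax _) (there (here p)) = there (here p)
  names⊆fn (cut {P = P} {x = x} {A = A} {Γ = Γ} {y = y} {Δ = Δ} {𝒢 = 𝒢} D) z∈ =
    ∈-∖⁺ (∈-∖⁺ (names⊆fn D (∈-resp-↭ (↭-sym p) (there (there z∈))))
                (∈⇒≢ z∈ (head∉ (tail! u))))
         (∈⇒≢ z∈ (head∉ u ∘ there))
    where
    p = map⁺ proj₁ (merge-↭ (x , A) (y , dual A) Γ Δ (concat 𝒢))
    u = Unique-↭ p (distinct D)
  names⊆fn (mix {P = P} {𝒢 = 𝒢} {ℋ = ℋ} D E d) z∈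
    with ∈-++⁻ (names 𝒢) (subst (_ ∈_) (names-++ 𝒢 ℋ) z∈)
  ... | inj₁ z∈𝒢 = ∈-++⁺ˡ (names⊆fn D z∈𝒢)
  ... | inj₂ z∈ℋ = ∈-++⁺ʳ (fn P) (names⊆fn E z∈ℋ)
  names⊆fn (tensor D) (here p) = here p
  names⊆fn (tensor {y = y} {A = A} {Γ = Γ} {x = x} {B = B} {Δ = Δ} D) (there z∈) =
    there (∈-∖⁺ (names⊆fn D (∈-resp-↭ (↭-sym p) (there (there z∈)))) (∈⇒≢ z∈ (head∉ u ∘ there)))
    where
    p = map⁺ proj₁ (merge-↭ (y , A) (x , B) Γ Δ [])
    u = Unique-↭ p (distinct D)
  names⊆fn (one D) (here p) = here p
  names⊆fn (par D) (here p) = here p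
  names⊆fn (par D) (there z∈) =
    there (∈-∖⁺ (names⊆fn D (there (there z∈))) (∈⇒≢ z∈ (head∉ (distinct D) ∘ there)))
  names⊆fn (bot D _) (here p) = here p
  names⊆fn (bot D _) (there z∈) = there (names⊆fn D z∈)
  names⊆fn (plus₁ D) z∈ = there (names⊆fn D z∈)
  names⊆fn (plus₂ D) z∈ = there (names⊆fn D z∈)
  names⊆fn (with& D E) z∈ = there (∈-++⁺ˡ (names⊆fn D z∈))
  names⊆fn (bang D _) (here p) = here p
  names⊆fn (bang D _) (there z∈) =
    there (∈-∖⁺ (names⊆fn D (there z∈)) (∈⇒≢ z∈ (head∉ (distinct D))))
  names⊆fn (quest D _) (here p) = here p
  names⊆fn (quest D _) (there z∈) =
    there (∈-∖⁺ (names⊆fn D (there z∈)) (∈⇒≢ z∈ (head∉ (distinct D))))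
  names⊆fn (weak D _) (here p) = here p
  names⊆fn (weak D _) (there z∈) = there (names⊆fn D z∈)
  names⊆fn (contr D _) (here p) = here p
  names⊆fn (contr D _) (there z∈) =
    there (∈-∖⁺ (∈-∖⁺ (names⊆fn D (there (there z∈))) (∈⇒≢ z∈ (head∉ (tail! (distinct D)))))
                (∈⇒≢ z∈ (head∉ (distinct D) ∘ there)))
  names⊆fn (ex D) z∈ = there (names⊆fn D z∈)
  names⊆fn (all D) (here p) = here p
  names⊆fn (all {Γ = Γ} D) (there z∈) =
    there (names⊆fn D (there (subst (_ ∈_) (sym (names-map₂ wk Γ)) z∈)))
  names⊆fn (exch e D) z∈ = names⊆fn D (∈-resp-↭ (↭-sym (↭-names e)) z∈)

  ≋-reflexive : 𝒢 ≡ ℋ → 𝒢 ≋ ℋ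
  ≋-reflexive refl = Perm.refl (PW.refl ↭-refl)

  recast : 𝒢 ≡ ℋ → P ⊢ 𝒢 → P ⊢ ℋ
  recast eq = exch (≋-reflexive eq)

  ≋-map : ∀ {m n} {f : Env m → Env n} → (∀ {Γ Δ} → Γ ↭ Δ → f Γ ↭ f Δ) →
          ∀ {𝒢 ℋ} → 𝒢 ≋ ℋ → map f 𝒢 ≋ map f ℋ
  ≋-map f↭ (Perm.refl ps)     = Perm.refl (PW.map⁺ _ _ (PW.map f↭ ps))
  ≋-map f↭ (Perm.prep p e)    = Perm.prep (f↭ p) (≋-map f↭ e)
  ≋-map f↭ (Perm.swap p q e)  = Perm.swap (f↭ p) (f↭ q) (≋-map f↭ e)
  ≋-map f↭ (Perm.trans e e′)  = Perm.trans (≋-map f↭ e) (≋-map f↭ e′)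

  subᵉ : ∀ {m n} → (Fin m → Ty n) → Env m → Env n
  subᵉ σ = map (map₂ (sub σ))

  subʰ : ∀ {m n} → (Fin m → Ty n) → HEnv m → HEnv n
  subʰ σ = map (subᵉ σ)

  renᵉ : (Name → Name) → Env n → Env n
  renᵉ ρ = map (map₁ ρ)

  renʰ : (Name → Name) → HEnv n → HEnv n
  renʰ ρ = map (renᵉ ρ)

  names-subʰ : ∀ {m n} (σ : Fin m → Ty n) 𝒢 → names (subʰ σ 𝒢) ≡ names 𝒢
  names-subʰ σ 𝒢 = trans (cong dom (concat-map 𝒢)) (dom-map₂ (sub σ) (concat 𝒢))

  names-renʰ : (ρ : Name → Name) (𝒢 : HEnv n) → names (renʰ ρ 𝒢) ≡ map ρ (names 𝒢)
  names-renʰ ρ 𝒢 =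
    trans (cong dom (concat-map 𝒢)) (trans (sym (map-∘ (concat 𝒢))) (map-∘ (concat 𝒢)))

  dom-renᵉ : (ρ : Name → Name) (Γ : Env n) → dom (renᵉ ρ Γ) ≡ map ρ (dom Γ)
  dom-renᵉ ρ Γ = trans (sym (map-∘ Γ)) (map-∘ Γ)

  subᵉ-？ : ∀ {m n} (σ : Fin m → Ty n) Γ → subᵉ σ (？ᵉ Γ) ≡ ？ᵉ (subᵉ σ Γ)
  subᵉ-？ σ Γ = trans (sym (map-∘ Γ)) (map-∘ Γ)

  subᵉ-wk : ∀ {m n} (σ : Fin m → Ty n) Γ → subᵉ (exts σ) (wkᵉ Γ) ≡ wkᵉ (subᵉ σ Γ)
  subᵉ-wk σ Γ =
    trans (sym (map-∘ Γ)) (trans (map-cong (λ p → cong (proj₁ p ,_) (wk-sub σ (proj₂ p))) Γ) (map-∘ Γ))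

  renᵉ-？ : ∀ ρ (Γ : Env n) → renᵉ ρ (？ᵉ Γ) ≡ ？ᵉ (renᵉ ρ Γ)
  renᵉ-？ ρ Γ = trans (sym (map-∘ Γ)) (map-∘ Γ)

  renᵉ-wk : ∀ ρ (Γ : Env n) → renᵉ ρ (wkᵉ Γ) ≡ wkᵉ (renᵉ ρ Γ)
  renᵉ-wk ρ Γ = trans (sym (map-∘ Γ)) (map-∘ Γ)

  subD : ∀ {m n} (σ : Fin m → Ty n) {P : Proc m} {𝒢 : HEnv m} → P ⊢ 𝒢 → subP σ P ⊢ subʰ σ 𝒢
  subD σ (ax {x = x} {y = y} {A = A} x≢y) =
    recast (cong (λ B → [ (x , B) ∷ (y , sub σ A) ∷ [] ]) (sym (sub-dual σ A))) (ax x≢y)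
  subD σ (cut {x = x} {A = A} {Γ = Γ} {y = y} {Δ = Δ} {𝒢 = 𝒢} D) =
    recast (cong (_∷ subʰ σ 𝒢) (sym (map-++ _ Γ Δ)))
      (cut (recast (cong (λ B → ((x , sub σ A) ∷ subᵉ σ Γ) ∷ ((y , B) ∷ subᵉ σ Δ) ∷ subʰ σ 𝒢)
                         (sub-dual σ A))
                   (subD σ D)))
  subD σ (mix {𝒢 = 𝒢} {ℋ = ℋ} D E d) =
    recast (sym (map-++ _ 𝒢 ℋ))
      (mix (subD σ D) (subD σ E)
           (λ (p , q) → d (subst (_ ∈_) (names-subʰ σ 𝒢) p , subst (_ ∈_) (names-subʰ σ ℋ) q)))
  subD σ mix₀ = mix₀
  subD σ (tensor {Γ = Γ} {x = x} {Δ = Δ} D) =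
    recast (cong (λ Θ → [ (x , _) ∷ Θ ]) (sym (map-++ _ Γ Δ))) (tensor (subD σ D))
  subD σ (one D) = one (subD σ D)
  subD σ (par D) = par (subD σ D)
  subD σ (bot {Γ = Γ} D x∉) = bot (subD σ D) (∉-map₂ Γ x∉)
  subD σ (plus₁ D) = plus₁ (subD σ D)
  subD σ (plus₂ D) = plus₂ (subD σ D)
  subD σ (with& D E) = with& (subD σ D) (subD σ E)
  subD σ (bang {y = y} {A = A} {Γ = Γ} {x = x} D x∉) =
    recast (cong (λ Θ → [ (x , ！ sub σ A) ∷ Θ ]) (sym (subᵉ-？ σ Γ)))
      (bang (recast (cong (λ Θ → [ (y , sub σ A) ∷ Θ ]) (subᵉ-？ σ Γ)) (subD σ D)) (∉-map₂ Γ x∉))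
  subD σ (quest {Γ = Γ} D x∉) = quest (subD σ D) (∉-map₂ Γ x∉)
  subD σ (weak {Γ = Γ} D x∉) = weak (subD σ D) (∉-map₂ Γ x∉)
  subD σ (contr {Γ = Γ} D x∉) = contr (subD σ D) (∉-map₂ Γ x∉)
  subD σ (ex {x = x} {B = B} {A = A} {Γ = Γ} D) =
    ex (recast (cong (λ C → [ (x , C) ∷ subᵉ σ Γ ]) (sub-inst σ B A)) (subD σ D))
  subD σ (all {x = x} {B = B} {Γ = Γ} D) =
    all (recast (cong (λ Θ → [ (x , sub (exts σ) B) ∷ Θ ]) (subᵉ-wk σ Γ)) (subD (exts σ) D))
  subD σ (exch e D) = exch (≋-map (map⁺ _) e) (subD σ D)

  subᵉ-inst-wk : (A : Ty n) (Γ : Env n) → subᵉ (inst A) (wkᵉ Γ) ≡ Γ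
  subᵉ-inst-wk A []            = refl
  subᵉ-inst-wk A ((x , B) ∷ Γ) = cong₂ _∷_ (cong (x ,_) (inst-wk B A)) (subᵉ-inst-wk A Γ)

  update-same : ∀ ρ y z → (ρ [ y ↦ z ]) y ≡ z
  update-same ρ y z with y ≟ y
  ... | yes _  = refl
  ... | no y≢y = ⊥-elim (y≢y refl)

  update-other : ∀ ρ {y z a} → a ≢ y → (ρ [ y ↦ z ]) a ≡ ρ a
  update-other ρ {y} {z} {a} a≢y with a ≟ y
  ... | yes a≡y = ⊥-elim (a≢y a≡y)
  ... | no _    = refl

  renᵉ-update : ∀ ρ (Γ : Env n) → y ∉ dom Γ → renᵉ (ρ [ y ↦ z ]) Γ ≡ renᵉ ρ Γ
  renᵉ-update ρ []      y∉ = refl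
  renᵉ-update ρ (_ ∷ Γ) y∉ =
    cong₂ _∷_ (cong (_, _) (update-other ρ (λ { refl → y∉ (here refl) }))) (renᵉ-update ρ Γ (y∉ ∘ there))

  renʰ-update : ∀ ρ (𝒢 : HEnv n) → y ∉ names 𝒢 → renʰ (ρ [ y ↦ z ]) 𝒢 ≡ renʰ ρ 𝒢
  renʰ-update ρ []      y∉ = refl
  renʰ-update ρ (Γ ∷ 𝒢) y∉ = cong₂ _∷_ (renᵉ-update ρ Γ (y∉′ ∘ ∈-++⁺ˡ)) (renʰ-update ρ 𝒢 (y∉′ ∘ ∈-++⁺ʳ (dom Γ)))
    where y∉′ = subst (_ ∉_) (map-++ proj₁ Γ (concat 𝒢)) y∉

  update-injective : ∀ ρ xs → InjectiveOn ρ (xs ∖ y) → z ∉ map ρ xs → InjectiveOn (ρ [ y ↦ z ]) xs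
  update-injective {y} {z} ρ xs inj z∉ {a} {b} a∈ b∈ eq with a ≟ y | b ≟ y
  ... | yes refl | yes refl = refl
  ... | yes _    | no _     = ⊥-elim (z∉ (subst (_∈ map ρ xs) (sym eq) (∈-map⁺ ρ b∈)))
  ... | no _     | yes _    = ⊥-elim (z∉ (subst (_∈ map ρ xs) eq (∈-map⁺ ρ a∈)))
  ... | no a≢y   | no b≢y   = inj (∈-∖⁺ a∈ a≢y) (∈-∖⁺ b∈ b≢y) eq

  update₂-injective : ∀ ρ xs → InjectiveOn ρ (xs ∖ y ∖ x) → z ∉ map ρ xs → w ∉ z ∷ map ρ xs →
                      InjectiveOn (ρ [ x ↦ z ] [ y ↦ w ]) xs
  update₂-injective {y} {x} {z} {w} ρ xs inj z∉ w∉ = update-injective (ρ [ x ↦ z ]) xs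
    (update-injective ρ (xs ∖ y) inj (z∉ ∘ shrink)) (w∉ ∘ image)
    where
    shrink : ∀ {a} → a ∈ map ρ (xs ∖ y) → a ∈ map ρ xs
    shrink p with b , b∈ , refl ← ∈-map⁻ ρ p = ∈-map⁺ ρ (proj₁ (∈-∖⁻ xs b∈))
    image : ∀ {a} → a ∈ map (ρ [ x ↦ z ]) xs → a ∈ z ∷ map ρ xs
    image p with b , b∈ , refl ← ∈-map⁻ (ρ [ x ↦ z ]) p with b ≟ x
    ... | yes _ = here refl
    ... | no _  = there (∈-map⁺ ρ b∈)

  ∉-image : ∀ {ρ xs ys} → InjectiveOn ρ xs → x ∈ xs → (∀ {z} → z ∈ ys → z ∈ xs) → x ∉ ys → ρ x ∉ map ρ ys
  ∉-image {ρ = ρ} inj x∈ ys⊆ x∉ p with a , a∈ , eq ← ∈-map⁻ ρ p =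
    x∉ (subst (_∈ _) (sym (inj x∈ (ys⊆ a∈) eq)) a∈)

  ∉-renᵉ : ∀ {ρ xs} (Γ : Env n) → InjectiveOn ρ (x ∷ xs) → (∀ {z} → z ∈ dom Γ → z ∈ xs) → x ∉ dom Γ →
           ρ x ∉ dom (renᵉ ρ Γ)
  ∉-renᵉ {ρ = ρ} Γ inj Γ⊆ x∉ =
    subst (_ ∉_) (sym (dom-renᵉ ρ Γ)) (∉-image inj (here refl) (there ∘ Γ⊆) x∉)

  new∉ : ∀ xs → new xs ∉ xs
  new∉ xs = proj₂ (fresh xs)

  dom⊆ : (Γ : Env n) → z ∈ dom Γ → z ∈ names [ Γ ]
  dom⊆ Γ = subst (_ ∈_) (sym (names-[] Γ))

  renD : ∀ ρ → P ⊢ 𝒢 → InjectiveOn ρ (fn P) → P ⟨ ρ ⟩ ⊢ renʰ ρ 𝒢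
  renD ρ (ax x≢y) inj = ax (x≢y ∘ inj (here refl) (there (here refl)))
  renD ρ (cut {P = P} {x = x} {A = A} {Γ = Γ} {y = y} {Δ = Δ} {𝒢 = 𝒢} D) inj =
    recast (cong (_∷ renʰ ρ 𝒢) (sym (map-++ _ Γ Δ)))
      (cut (recast (cong₂ _∷_ (cong₂ _∷_ (cong (_, A) x≡) eqΓ)
                     (cong₂ _∷_ (cong₂ _∷_ (cong (_, dual A) (update-same (ρ [ x ↦ x⁺ ]) y y⁺)) eqΔ) eq𝒢))
                   (renD ρ⁺ D (update₂-injective ρ (fn P) inj (new∉ _) (new∉ _)))))
    where
    x⁺ = new (map ρ (fn P))
    y⁺ = new (x⁺ ∷ map ρ (fn P))
    ρ⁺ = ρ [ x ↦ x⁺ ] [ y ↦ y⁺ ]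
    u : Unique (x ∷ y ∷ dom ((Γ ++ Δ) ++ concat 𝒢))
    u = Unique-↭ (map⁺ proj₁ (merge-↭ (x , A) (y , dual A) Γ Δ (concat 𝒢))) (distinct D)
    x≢y : x ≢ y
    x≢y refl = head∉ u (here refl)
    x≡ : ρ⁺ x ≡ x⁺
    x≡ = trans (update-other (ρ [ x ↦ x⁺ ]) x≢y) (update-same ρ x x⁺)
    all≡ : ∀ 𝒦 → (∀ {z} → z ∈ names 𝒦 → z ∈ dom ((Γ ++ Δ) ++ concat 𝒢)) → renʰ ρ⁺ 𝒦 ≡ renʰ ρ 𝒦
    all≡ 𝒦 𝒦⊆ = trans (renʰ-update (ρ [ x ↦ x⁺ ]) 𝒦 (head∉ (tail! u) ∘ 𝒦⊆))
                        (renʰ-update ρ 𝒦 (head∉ u ∘ there ∘ 𝒦⊆))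
    inject : ∀ {z} → z ∈ dom Γ ⊎ z ∈ dom Δ ⊎ z ∈ names 𝒢 → z ∈ dom ((Γ ++ Δ) ++ concat 𝒢)
    inject z∈ = subst (_ ∈_) (sym (trans (map-++ proj₁ (Γ ++ Δ) (concat 𝒢))
                                    (cong (_++ names 𝒢) (map-++ proj₁ Γ Δ)))) (go z∈)
      where
      go : ∀ {z} → z ∈ dom Γ ⊎ z ∈ dom Δ ⊎ z ∈ names 𝒢 → z ∈ (dom Γ ++ dom Δ) ++ names 𝒢
      go (inj₁ p)        = ∈-++⁺ˡ (∈-++⁺ˡ p)
      go (inj₂ (inj₁ p)) = ∈-++⁺ˡ (∈-++⁺ʳ (dom Γ) p)
      go (inj₂ (inj₂ p)) = ∈-++⁺ʳ (dom Γ ++ dom Δ) p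
    env≡ : ∀ Θ → (∀ {z} → z ∈ dom Θ → z ∈ dom ((Γ ++ Δ) ++ concat 𝒢)) → renᵉ ρ⁺ Θ ≡ renᵉ ρ Θ
    env≡ Θ Θ⊆ = trans (renᵉ-update (ρ [ x ↦ x⁺ ]) Θ (head∉ (tail! u) ∘ Θ⊆))
                      (renᵉ-update ρ Θ (head∉ u ∘ there ∘ Θ⊆))
    eqΓ = env≡ Γ (inject ∘ inj₁)
    eqΔ = env≡ Δ (inject ∘ inj₂ ∘ inj₁)
    eq𝒢 = all≡ 𝒢 (inject ∘ inj₂ ∘ inj₂)
  renD ρ (mix {P = P} {𝒢 = 𝒢} {ℋ = ℋ} D E d) inj =
    recast (sym (map-++ _ 𝒢 ℋ))
      (mix (renD ρ D (λ a∈ b∈ → inj (∈-++⁺ˡ a∈) (∈-++⁺ˡ b∈)))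
           (renD ρ E (λ a∈ b∈ → inj (∈-++⁺ʳ (fn P) a∈) (∈-++⁺ʳ (fn P) b∈)))
           apart)
    where
    apart : Disjoint (names (renʰ ρ 𝒢)) (names (renʰ ρ ℋ))
    apart (p , q)
      with a , a∈ , refl ← ∈-map⁻ ρ (subst (_ ∈_) (names-renʰ ρ 𝒢) p)
         | b , b∈ , eq   ← ∈-map⁻ ρ (subst (_ ∈_) (names-renʰ ρ ℋ) q)
      with refl ← inj (∈-++⁺ˡ (names⊆fn D a∈)) (∈-++⁺ʳ (fn P) (names⊆fn E b∈)) eq = d (a∈ , b∈)
  renD ρ mix₀ inj = mix₀
  renD ρ (tensor {P = P} {y = y} {A = A} {Γ = Γ} {x = x} {B = B} {Δ = Δ} D) inj =
    recast (cong (λ Θ → [ (ρ x , A ⊗ B) ∷ Θ ]) (sym (map-++ _ Γ Δ)))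
      (tensor (recast (cong₂ (λ Γ Δ → Γ ∷ Δ ∷ [])
                        (cong₂ _∷_ (cong (_, A) (update-same ρ y y⁺)) (renᵉ-update ρ Γ (y∉ ∘ inΓ)))
                        (renᵉ-update ρ ((x , B) ∷ Δ) (y∉ ∘ inΔ)))
                      (renD (ρ [ y ↦ y⁺ ]) D
                        (update-injective ρ (fn P) (λ a∈ b∈ → inj (there a∈) (there b∈)) (new∉ _)))))
    where
    y⁺ = new (map ρ (fn P))
    y∉ = head∉ (distinct D)
    names≡ = trans (map-++ proj₁ Γ (concat [ (x , B) ∷ Δ ])) (cong (dom Γ ++_) (names-[] ((x , B) ∷ Δ)))
    inΓ : ∀ {z} → z ∈ dom Γ → z ∈ dom (Γ ++ (x , B) ∷ Δ ++ [])
    inΓ p = subst (_ ∈_) (sym names≡) (∈-++⁺ˡ p)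
    inΔ : ∀ {z} → z ∈ x ∷ dom Δ → z ∈ dom (Γ ++ (x , B) ∷ Δ ++ [])
    inΔ p = subst (_ ∈_) (sym names≡) (∈-++⁺ʳ (dom Γ) p)
  renD ρ (one D) inj = one (renD ρ D (λ a∈ b∈ → inj (there a∈) (there b∈)))
  renD ρ (par {P = P} {y = y} {A = A} {x = x} {B = B} {Γ = Γ} D) inj =
    par (recast (cong [_] (cong₂ _∷_ (cong (_, A) (update-same ρ y y⁺))
                                     (renᵉ-update ρ ((x , B) ∷ Γ) (head∉ (distinct D) ∘ dom⊆ ((x , B) ∷ Γ)))))
                (renD (ρ [ y ↦ y⁺ ]) D
                  (update-injective ρ (fn P) (λ a∈ b∈ → inj (there a∈) (there b∈)) (new∉ _))))
    where y⁺ = new (map ρ (fn P))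
  renD ρ (bot {Γ = Γ} D x∉) inj =
    bot (renD ρ D (λ a∈ b∈ → inj (there a∈) (there b∈))) (∉-renᵉ Γ inj (names⊆fn D ∘ dom⊆ Γ) x∉)
  renD ρ (plus₁ D) inj = plus₁ (renD ρ D (λ a∈ b∈ → inj (there a∈) (there b∈)))
  renD ρ (plus₂ D) inj = plus₂ (renD ρ D (λ a∈ b∈ → inj (there a∈) (there b∈)))
  renD ρ (with& {P = P} D E) inj =
    with& (renD ρ D (λ a∈ b∈ → inj (there (∈-++⁺ˡ a∈)) (there (∈-++⁺ˡ b∈))))
          (renD ρ E (λ a∈ b∈ → inj (there (∈-++⁺ʳ (fn P) a∈)) (there (∈-++⁺ʳ (fn P) b∈))))
  renD ρ (bang {P = P} {y = y} {A = A} {Γ = Γ} {x = x} D x∉) inj =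
    recast (cong (λ Θ → [ (ρ x , ！ A) ∷ Θ ]) (sym (renᵉ-？ ρ Γ)))
      (bang (recast (cong [_] (cong₂ _∷_ (cong (_, A) (update-same ρ y y⁺))
                      (trans (renᵉ-update ρ (？ᵉ Γ) (y∉ ∘ dom⊆ (？ᵉ Γ))) (renᵉ-？ ρ Γ))))
              (renD (ρ [ y ↦ y⁺ ]) D
                (update-injective ρ (fn P) (λ a∈ b∈ → inj (there a∈) (there b∈)) (new∉ _))))
            (∉-renᵉ Γ inj
              (λ z∈ → let z∈′ = dom⊆ (？ᵉ Γ) (subst (_ ∈_) (sym (dom-map₂ ？_ Γ)) z∈) in
                      ∈-∖⁺ (names⊆fn D (there z∈′)) (∈⇒≢ z∈′ y∉))
              x∉))
    where
    y⁺ = new (map ρ (fn P))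
    y∉ = head∉ (distinct D)
  renD ρ (quest {P = P} {y = y} {A = A} {Γ = Γ} D x∉) inj =
    quest (recast (cong [_] (cong₂ _∷_ (cong (_, A) (update-same ρ y y⁺)) (renᵉ-update ρ Γ (y∉ ∘ dom⊆ Γ))))
            (renD (ρ [ y ↦ y⁺ ]) D
              (update-injective ρ (fn P) (λ a∈ b∈ → inj (there a∈) (there b∈)) (new∉ _))))
          (∉-renᵉ Γ inj (λ z∈ → ∈-∖⁺ (names⊆fn D (there (dom⊆ Γ z∈))) (∈⇒≢ (dom⊆ Γ z∈) y∉)) x∉)
    where
    y⁺ = new (map ρ (fn P))
    y∉ = head∉ (distinct D)
  renD ρ (weak {Γ = Γ} D x∉) inj =
    weak (renD ρ D (λ a∈ b∈ → inj (there a∈) (there b∈))) (∉-renᵉ Γ inj (names⊆fn D ∘ dom⊆ Γ) x∉)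
  renD ρ (contr {P = P} {x₁ = x₁} {A = A} {x₂ = x₂} {Γ = Γ} D x∉) inj =
    contr (recast (cong [_] (cong₂ _∷_ (cong (_, ？ A) x₁≡)
                              (cong₂ _∷_ (cong (_, ？ A) (update-same (ρ [ x₁ ↦ x₁⁺ ]) x₂ x₂⁺))
                                (trans (renᵉ-update (ρ [ x₁ ↦ x₁⁺ ]) Γ (x₂∉ ∘ dom⊆ Γ))
                                       (renᵉ-update ρ Γ (x₁∉ ∘ there ∘ dom⊆ Γ))))))
            (renD _ D (update₂-injective ρ (fn P) (λ a∈ b∈ → inj (there a∈) (there b∈)) (new∉ _) (new∉ _))))
          (∉-renᵉ Γ inj
            (λ z∈ → let z∈′ = dom⊆ Γ z∈ in
                    ∈-∖⁺ (∈-∖⁺ (names⊆fn D (there (there z∈′))) (∈⇒≢ z∈′ x₂∉)) (∈⇒≢ z∈′ (x₁∉ ∘ there)))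
            x∉)
    where
    x₁⁺ = new (map ρ (fn P))
    x₂⁺ = new (x₁⁺ ∷ map ρ (fn P))
    x₁∉ = head∉ (distinct D)
    x₂∉ = head∉ (tail! (distinct D))
    x₁≡ : (ρ [ x₁ ↦ x₁⁺ ] [ x₂ ↦ x₂⁺ ]) x₁ ≡ x₁⁺
    x₁≡ = trans (update-other (ρ [ x₁ ↦ x₁⁺ ]) (λ { refl → x₁∉ (here refl) })) (update-same ρ x₁ x₁⁺)
  renD ρ (ex D) inj = ex (renD ρ D (λ a∈ b∈ → inj (there a∈) (there b∈)))
  renD ρ (all {x = x} {B = B} {Γ = Γ} D) inj =
    all (recast (cong (λ Θ → [ (ρ x , B) ∷ Θ ]) (renᵉ-wk ρ Γ))
                (renD ρ D (λ a∈ b∈ → inj (there a∈) (there b∈))))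
  renD ρ (exch e D) inj = exch (≋-map (map⁺ _) e) (renD ρ D inj)

  env-≋ : Γ ↭ Δ → [ Γ ] ≋ [ Δ ]
  env-≋ p = Perm.prep p (Perm.refl [])

  dropsD : (Γ : Env n) → Unique (dom (Γ ++ Θ)) → Q ⊢ [ Θ ] → drops (dom Γ) Q ⊢ [ ？ᵉ Γ ++ Θ ]
  dropsD []                  u D = D
  dropsD {Θ = Θ} ((z , A) ∷ Γ) u D =
    weak (dropsD Γ (tail! u) D) (subst (z ∉_) dom≡ (head∉ u))
    where
    dom≡ : dom (Γ ++ Θ) ≡ dom (？ᵉ Γ ++ Θ)
    dom≡ = trans (map-++ proj₁ Γ Θ)
                 (trans (cong (_++ dom Θ) (sym (dom-map₂ ？_ Γ))) (sym (map-++ proj₁ (？ᵉ Γ) Θ)))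

  dupsD : (Γ : Env n) → Unique (dom Γ) → Disjoint (dom Γ) (dom Θ) →
          (∀ {z w} → z ∈ dom Γ → w ∈ dom Γ → σ₁ z ≡ w → z ≡ w) →
          (∀ {z w} → z ∈ dom Γ → w ∈ dom Γ → σ₂ z ≡ w → z ≡ w) →
          Q ⊢ [ ？ᵉ (renᵉ σ₁ Γ) ++ ？ᵉ (renᵉ σ₂ Γ) ++ Θ ] → dups σ₁ σ₂ (dom Γ) Q ⊢ [ ？ᵉ Γ ++ Θ ]
  dupsD []                             u d c₁ c₂ D = D
  dupsD {Θ = Θ} {σ₁ = σ₁} {σ₂ = σ₂} ((z , A) ∷ Γ) u d c₁ c₂ D =
    contr (exch (env-≋ pull)
            (dupsD {Θ = p ∷ q ∷ Θ} Γ (tail! u) d′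
              (λ z∈ w∈ → c₁ (there z∈) (there w∈)) (λ z∈ w∈ → c₂ (there z∈) (there w∈))
              (exch (env-≋ push) D)))
          z∉
    where
    p = (σ₁ z , ？ A)
    q = (σ₂ z , ？ A)
    X = ？ᵉ (renᵉ σ₁ Γ)
    Y = ？ᵉ (renᵉ σ₂ Γ)
    pull : ？ᵉ Γ ++ p ∷ q ∷ Θ ↭ p ∷ q ∷ ？ᵉ Γ ++ Θ
    pull = ↭-trans (shift p (？ᵉ Γ) (q ∷ Θ)) (↭.prep p (shift q (？ᵉ Γ) Θ))
    push : p ∷ X ++ q ∷ Y ++ Θ ↭ X ++ Y ++ p ∷ q ∷ Θ
    push = ↭-trans (↭-sym (shift p X (q ∷ Y ++ Θ)))
      (++⁺ˡ X (↭-trans (↭.prep p (↭-sym (shift q Y Θ))) (↭-sym (shift p Y (q ∷ Θ)))))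
    d′ : Disjoint (dom Γ) (σ₁ z ∷ σ₂ z ∷ dom Θ)
    d′ (w∈ , here refl)         = head∉ u (subst (_∈ dom Γ) (sym (c₁ (here refl) (there w∈) refl)) w∈)
    d′ (w∈ , there (here refl)) = head∉ u (subst (_∈ dom Γ) (sym (c₂ (here refl) (there w∈) refl)) w∈)
    d′ (w∈ , there (there w∈Θ)) = d (there w∈ , w∈Θ)
    z∉ : z ∉ dom (？ᵉ Γ ++ Θ)
    z∉ z∈ with ∈-++⁻ (dom (？ᵉ Γ)) (subst (z ∈_) (map-++ proj₁ (？ᵉ Γ) Θ) z∈)
    ... | inj₁ z∈Γ = head∉ u (subst (z ∈_) (dom-map₂ ？_ Γ) z∈Γ)
    ... | inj₂ z∈Θ = d (here refl , z∈Θ)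

  copyD : Copying P x′ (dom Γ) x₁ x₂ σ₁ σ₂ → P ⊢ [ (x′ , A) ∷ ？ᵉ Γ ] →
          dups σ₁ σ₂ (dom Γ)
            (out x₁ x₂ (serve x₁ (σ₁ x′) (P ⟨ σ₁ ⟩) ∥ serve x₂ (σ₂ x′) (P ⟨ σ₂ ⟩)))
            ⊢ [ ？ᵉ Γ ++ [ (x₁ , ！ A ⊗ ！ A) ] ]
  copyD {P = P} {x′ = x′} {Γ = Γ} {x₁ = x₁} {x₂ = x₂} {σ₁ = σ₁} {σ₂ = σ₂} {A = A} c D =
    dupsD Γ (proj₁ enumerates) (λ { (z∈ , here refl) → x₁-fresh (∈-++⁺ˡ z∈) }) uncaptured₁ uncaptured₂
      (exch (env-≋ order)
        (tensor (exch (Perm.swap ↭-refl ↭-refl (Perm.refl []))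
          (mix (bang D₁ x₁∉) (bang D₂ x₂∉) disjoint))))
    where
    open Copying c
    Γ₁⁺ = renᵉ σ₁ Γ
    Γ₂⁺ = renᵉ σ₂ Γ
    D₁ : P ⟨ σ₁ ⟩ ⊢ [ (σ₁ x′ , A) ∷ ？ᵉ Γ₁⁺ ]
    D₁ = recast (cong (λ Θ → [ (σ₁ x′ , A) ∷ Θ ]) (renᵉ-？ σ₁ Γ)) (renD σ₁ D injective₁)
    D₂ : P ⟨ σ₂ ⟩ ⊢ [ (σ₂ x′ , A) ∷ ？ᵉ Γ₂⁺ ]
    D₂ = recast (cong (λ Θ → [ (σ₂ x′ , A) ∷ Θ ]) (renᵉ-？ σ₂ Γ)) (renD σ₂ D injective₂)
    in₁ : ∀ {z} → z ∈ names [ ？ᵉ Γ₁⁺ ] → z ∈ map σ₁ (dom Γ)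
    in₁ = subst (_ ∈_) (trans (names-[] (？ᵉ Γ₁⁺)) (trans (dom-map₂ ？_ Γ₁⁺) (dom-renᵉ σ₁ Γ)))
    in₂ : ∀ {z} → z ∈ names [ ？ᵉ Γ₂⁺ ] → z ∈ map σ₂ (dom Γ)
    in₂ = subst (_ ∈_) (trans (names-[] (？ᵉ Γ₂⁺)) (trans (dom-map₂ ？_ Γ₂⁺) (dom-renᵉ σ₂ Γ)))
    x₁∉ : x₁ ∉ dom Γ₁⁺
    x₁∉ p = x₁-fresh (∈-++⁺ʳ (dom Γ) (∈-++⁺ˡ (subst (x₁ ∈_) (dom-renᵉ σ₁ Γ) p)))
    x₂∉ : x₂ ∉ dom Γ₂⁺
    x₂∉ p = x₂-fresh (∈-++⁺ʳ (dom Γ) (∈-++⁺ʳ (map σ₁ (dom Γ)) (subst (x₂ ∈_) (dom-renᵉ σ₂ Γ) p)))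
    disjoint : Disjoint (names [ (x₁ , ！ A) ∷ ？ᵉ Γ₁⁺ ]) (names [ (x₂ , ！ A) ∷ ？ᵉ Γ₂⁺ ])
    disjoint (here refl , here eq)   = x₁≢x₂ eq
    disjoint (here refl , there q)   = x₁-fresh (∈-++⁺ʳ (dom Γ) (∈-++⁺ʳ (map σ₁ (dom Γ)) (in₂ q)))
    disjoint (there p   , here refl) = x₂-fresh (∈-++⁺ʳ (dom Γ) (∈-++⁺ˡ (in₁ p)))
    disjoint (there p   , there q)   = apart (names⊆fn D₁ (there p) , names⊆fn D₂ (there q))
    order : (x₁ , ！ A ⊗ ！ A) ∷ ？ᵉ Γ₂⁺ ++ ？ᵉ Γ₁⁺ ↭ ？ᵉ Γ₁⁺ ++ ？ᵉ Γ₂⁺ ++ [ (x₁ , ！ A ⊗ ！ A) ]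
    order = ↭-trans (++-comm [ (x₁ , ！ A ⊗ ！ A) ] (？ᵉ Γ₂⁺ ++ ？ᵉ Γ₁⁺))
      (↭-trans (++⁺ʳ [ _ ] (++-comm (？ᵉ Γ₂⁺) (？ᵉ Γ₁⁺)))
               (↭-reflexive (++-assoc (？ᵉ Γ₁⁺) (？ᵉ Γ₂⁺) [ _ ])))

  infix 3 _—[_]→ᵈ_ _—[_]→ᴰ_

  -- Since `exch` only permutes the representation of a hyperenvironment, it is
  -- ignored at the source (exchˢ) and at the target (exchᵗ) of a transition;
  -- the arguments e of other rules realign lists in the same way.
  data _—[_]→ᵈ_ {n : ℕ} : {P P′ : Proc n} {𝒢 𝒢′ : HEnv n} → P ⊢ 𝒢 → Label n → P′ ⊢ 𝒢′ → Set where
    exchˢ : {e : 𝒢 ≋ ℋ} {D : P ⊢ 𝒢} {D′ : P′ ⊢ 𝒢′} → D —[ l ]→ᵈ D′ → exch e D —[ l ]→ᵈ D′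
    exchᵗ : {e : 𝒢′ ≋ ℋ′} {D : P ⊢ 𝒢} {D′ : P′ ⊢ 𝒢′} → D —[ l ]→ᵈ D′ → D —[ l ]→ᵈ exch e D′

    out   : {D : P ⊢ ((y , A) ∷ Γ) ∷ ((x , B) ∷ Δ) ∷ []} → tensor D —[ act (out x y) ]→ᵈ D
    inp   : {D : P ⊢ [ (y , A) ∷ (x , B) ∷ Γ ]} → par D —[ act (inp x y) ]→ᵈ D
    close : {D : P ⊢ []} → one {x = x} D —[ act (close x) ]→ᵈ D
    wait  : {D : P ⊢ [ Γ ]} {x∉ : x ∉ dom Γ} → bot D x∉ —[ act (wait x) ]→ᵈ D
    inl   : {D : P ⊢ [ (x , A) ∷ Γ ]} → plus₁ {B = B} D —[ act (inl x) ]→ᵈ D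
    inr   : {D : P ⊢ [ (x , B) ∷ Γ ]} → plus₂ {A = A} D —[ act (inr x) ]→ᵈ D
    outT  : {D : P ⊢ [ (x , B [ A ]ᵗ) ∷ Γ ]} → ex {B = B} D —[ act (outT x A) ]→ᵈ D
    use   : {D : P ⊢ [ (y , A) ∷ Γ ]} {x∉ : x ∉ dom Γ} → quest D x∉ —[ act (use x y) ]→ᵈ D
    serve : {D : P ⊢ [ (y , A) ∷ ？ᵉ Γ ]} {x∉ : x ∉ dom Γ} →
            bang {Γ = Γ} D x∉ —[ act (serve x y) ]→ᵈ D

    coinl : {D : P ⊢ [ (x , A) ∷ Γ ]} {E : Q ⊢ [ (x , B) ∷ Γ ]} → with& D E —[ act (coinl x) ]→ᵈ D
    coinr : {D : P ⊢ [ (x , A) ∷ Γ ]} {E : Q ⊢ [ (x , B) ∷ Γ ]} → with& D E —[ act (coinr x) ]→ᵈ E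
    inpT  : {D : P ⊢ [ (x , B) ∷ wkᵉ Γ ]} → all {Γ = Γ} D —[ act (inpT x A) ]→ᵈ subD (inst A) D
    drop  : {D : P ⊢ [ Γ ]} {x∉ : x ∉ dom Γ} → weak {A = A} D x∉ —[ act (drop x) ]→ᵈ bot D x∉
    dup   : {D : P ⊢ [ (x₁ , ？ A) ∷ (x₂ , ？ A) ∷ Γ ]} {x∉ : x ∉ dom Γ}
            (e : [ (x₁ , ？ A) ∷ (x₂ , ？ A) ∷ Γ ] ≋ [ (x₂ , ？ A) ∷ (x₁ , ？ A) ∷ Γ ]) →
            contr D x∉ —[ act (dup x x₁ x₂) ]→ᵈ par (exch e D)

    -- The entries of ?Γ are listed as Γ′, in the order chosen for z₁,…,zₙ.
    codrop : {D : P ⊢ [ (x′ , A) ∷ ？ᵉ Γ ]} {x∉ : x ∉ dom Γ} →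
             Γ ↭ Γ′ → dom Γ′ Enumerates (fn P ∖ x′) → (u : Unique (dom (Γ′ ++ [ (x , 𝟏) ]))) →
             bang {Γ = Γ} D x∉ —[ act (codrop x) ]→ᵈ dropsD Γ′ u (one mix₀)
    codup  : {D : P ⊢ [ (x′ , A) ∷ ？ᵉ Γ ]} {x∉ : x ∉ dom Γ}
             (e : [ (x′ , A) ∷ ？ᵉ Γ ] ≋ [ (x′ , A) ∷ ？ᵉ Γ′ ])
             (c : Copying P x′ (dom Γ′) x₁ x₂ σ₁ σ₂) →
             bang {Γ = Γ} D x∉ —[ act (codup x x₁ x₂) ]→ᵈ copyD {Γ = Γ′} c (exch e D)

    link₁ : {x≢y : x ≢ y} → ax {A = A} x≢y —[ link x y ]→ᵈ mix₀
    link₂ : {x≢y : x ≢ y} → ax {A = A} x≢y —[ link y x ]→ᵈ mix₀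

    alpha : {D : P ⊢ 𝒢} {E : Q ⊢ 𝒢} {F : R ⊢ 𝒢′} → P =α Q → E —[ l ]→ᵈ F → D —[ l ]→ᵈ F

    parˡ : {D : P ⊢ 𝒢} {D′ : P′ ⊢ 𝒢′} {E : Q ⊢ ℋ}
           {d : Disjoint (names 𝒢) (names ℋ)} {d′ : Disjoint (names 𝒢′) (names ℋ)} →
           D —[ l ]→ᵈ D′ → Disjoint (bnˡ l) (fn Q) → mix D E d —[ l ]→ᵈ mix D′ E d′
    parʳ : {D : P ⊢ 𝒢} {E : Q ⊢ ℋ} {E′ : Q′ ⊢ ℋ′}
           {d : Disjoint (names 𝒢) (names ℋ)} {d′ : Disjoint (names 𝒢) (names ℋ′)} →
           E —[ l ]→ᵈ E′ → Disjoint (bnˡ l) (fn P) → mix D E d —[ l ]→ᵈ mix D E′ d′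
    syn  : {D : P ⊢ 𝒢} {D′ : P′ ⊢ 𝒢′} {E : Q ⊢ ℋ} {E′ : Q′ ⊢ ℋ′}
           {d : Disjoint (names 𝒢) (names ℋ)} {d′ : Disjoint (names 𝒢′) (names ℋ′)} →
           D —[ act a ]→ᵈ D′ → E —[ act b ]→ᵈ E′ → Disjoint (bnᵃ a) (bnᵃ b) →
           Disjoint (bnᵃ a) (fn Q) → Disjoint (bnᵃ b) (fn P) →
           mix D E d —[ pair a b ]→ᵈ mix D′ E′ d′
    flip : {D : P ⊢ 𝒢} {D′ : P′ ⊢ 𝒢′} → D —[ pair a b ]→ᵈ D′ → D —[ pair b a ]→ᵈ D′

    res  : {D  : P  ⊢ ((x , A) ∷ Γ)  ∷ ((y , dual A) ∷ Δ)  ∷ 𝒢}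
           {D′ : P′ ⊢ ((x , A) ∷ Γ′) ∷ ((y , dual A) ∷ Δ′) ∷ 𝒢′} →
           D —[ l ]→ᵈ D′ → x ∉ cn l → y ∉ cn l → cut {A = A} D —[ l ]→ᵈ cut {A = A} D′

    τ-close : {D  : P  ⊢ [ (x , 𝟏) ] ∷ ((y , ⊥̇) ∷ Δ) ∷ 𝒢}
              {D′ : P′ ⊢ Δ ∷ 𝒢} →
              D —[ pair (close x) (wait y) ]→ᵈ D′ → cut {A = 𝟏} D —[ τ ]→ᵈ D′
    τ-out   : {D  : P  ⊢ ((x , A ⊗ B) ∷ Γ₁ ++ Γ₂) ∷ ((y , dual A ⅋ dual B) ∷ Δ) ∷ 𝒢}
              {D′ : P′ ⊢ ((x′ , A) ∷ Γ₂) ∷ ((y′ , dual A) ∷ (y , dual B) ∷ Δ) ∷ ((x , B) ∷ Γ₁) ∷ 𝒢}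
              (e : (Γ₂ ++ (y , dual B) ∷ Δ) ∷ ((x , B) ∷ Γ₁) ∷ 𝒢
                     ≋ ((x , B) ∷ Γ₁) ∷ ((y , dual B) ∷ Γ₂ ++ Δ) ∷ 𝒢) →
              D —[ pair (out x x′) (inp y y′) ]→ᵈ D′ →
              cut {A = A ⊗ B} D —[ τ ]→ᵈ cut {A = B} (exch e (cut {A = A} D′))
    τ-inl   : {D  : P  ⊢ ((x , A ⊕ B) ∷ Γ) ∷ ((y , dual A & dual B) ∷ Δ) ∷ 𝒢}
              {D′ : P′ ⊢ ((x , A) ∷ Γ) ∷ ((y , dual A) ∷ Δ) ∷ 𝒢} →
              D —[ pair (inl x) (coinl y) ]→ᵈ D′ → cut {A = A ⊕ B} D —[ τ ]→ᵈ cut {A = A} D′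
    τ-inr   : {D  : P  ⊢ ((x , A ⊕ B) ∷ Γ) ∷ ((y , dual A & dual B) ∷ Δ) ∷ 𝒢}
              {D′ : P′ ⊢ ((x , B) ∷ Γ) ∷ ((y , dual B) ∷ Δ) ∷ 𝒢} →
              D —[ pair (inr x) (coinr y) ]→ᵈ D′ → cut {A = A ⊕ B} D —[ τ ]→ᵈ cut {A = B} D′
    τ-outT  : {B : Ty (suc n)} {D : P ⊢ ((x , ‵∃ B) ∷ Γ) ∷ ((y , ‵∀ dual B) ∷ Δ) ∷ 𝒢}
              {D′ : P′ ⊢ ((x , B [ A ]ᵗ) ∷ Γ) ∷ ((y , dual (B [ A ]ᵗ)) ∷ Δ) ∷ 𝒢} →
              D —[ pair (outT x A) (inpT y A) ]→ᵈ D′ → cut {A = ‵∃ B} D —[ τ ]→ᵈ cut {A = B [ A ]ᵗ} D′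
    -- In τ-drop and τ-dup, Δ may have entries that are not of the form ?A,
    -- because the server on y may lie below a cut.
    τ-drop  : {D  : P  ⊢ ((x , ？ A) ∷ Γ) ∷ ((y , ！ dual A) ∷ Δ) ∷ 𝒢}
              {D′ : P′ ⊢ ((x , ⊥̇) ∷ Γ) ∷ ((y , 𝟏) ∷ Δ) ∷ 𝒢} →
              D —[ pair (drop x) (codrop y) ]→ᵈ D′ → cut {A = ？ A} D —[ τ ]→ᵈ cut {A = ⊥̇} D′
    τ-use   : {D  : P  ⊢ ((x , ？ A) ∷ Γ) ∷ ((y , ！ dual A) ∷ Δ) ∷ 𝒢}
              {D′ : P′ ⊢ ((x′ , A) ∷ Γ) ∷ ((y′ , dual A) ∷ Δ) ∷ 𝒢} →
              D —[ pair (use x x′) (serve y y′) ]→ᵈ D′ → cut {A = ？ A} D —[ τ ]→ᵈ cut {A = A} D′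
    τ-dup   : {D  : P  ⊢ ((x , ？ A) ∷ Γ) ∷ ((y , ！ dual A) ∷ Δ) ∷ 𝒢}
              {D′ : P′ ⊢ ((x₁ , ？ A ⅋ ？ A) ∷ Γ) ∷ ((y₁ , ！ dual A ⊗ ！ dual A) ∷ Δ) ∷ 𝒢} →
              D —[ pair (dup x x₁ x₂) (codup y y₁ y₂) ]→ᵈ D′ →
              cut {A = ？ A} D —[ τ ]→ᵈ cut {A = ？ A ⅋ ？ A} D′
    τ-link  : {D  : P  ⊢ ((x , A) ∷ Γ) ∷ ((y , dual A) ∷ (z , A) ∷ []) ∷ 𝒢}
              {D′ : P′ ⊢ ((x , A) ∷ Γ) ∷ 𝒢}
              (inj : InjectiveOn (id [ x ↦ z ]) (fn P′)) →
              D —[ link z y ]→ᵈ D′ → z ≢ x → z ≢ y →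
              cut {A = A} D —[ τ ]→ᵈ renD (id [ x ↦ z ]) D′ inj

  record Derivation (n : ℕ) : Set where
    constructor derivation
    field
      {proc} : Proc n
      {henv} : HEnv n
      tree   : proc ⊢ henv

  open Derivation public using (proc; henv; tree)

  _—[_]→ᴰ_ : Derivation n → Label n → Derivation n → Set
  D —[ l ]→ᴰ D′ = tree D —[ l ]→ᵈ tree D′

{-# OPTIONS --safe #-}

-- Derivation transitions erase to process transitions rule by rule.  Conversely,
-- a transition of proc(D) is replayed on D by induction on it, which needs session
-- fidelity: the label determines how the hyperenvironment changes.  An action
-- rewrites only the environment of its subject, a pair of actions does so twice, a
-- link erases its environment, and τ changes nothing.  Since all names are distinct,
-- these changes can be located in any representation of the hyperenvironment; so a
-- restriction keeps the two cut endpoints in separate environments, and the premise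
-- of a communication has the types that its rule requires.  Rule (α) is covered
-- because typing is invariant under α-equivalence.
module Submission where

open import Defs
open import Data.Empty using (⊥; ⊥-elim)
open import Data.List.Base using ([]; _∷_; [_]; _++_; concat)
open import Data.List.Membership.Propositional using (_∈_; _∉_)
open import Data.List.Membership.Propositional.Properties
  using (∈-++⁺ˡ; ∈-++⁺ʳ; ∈-++⁻; ∈-map⁺; ∈-map⁻; ∈-∃++)
open import Data.List.Properties using (map-++; map-id; ++-assoc)
open import Data.List.Relation.Binary.Disjoint.Propositional using (Disjoint)
open import Data.List.Relation.Binary.Permutation.Homogeneous as Perm using ()
open import Data.List.Relation.Binary.Permutation.Propositional as ↭
  using (_↭_; ↭-sym; ↭-trans; ↭-refl; ↭-reflexive)
open import Data.List.Relation.Binary.Permutation.Propositional.Properties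
  using (map⁺; ++⁺; ++⁺ˡ; ++⁺ʳ; ++-comm; shift; ∈-resp-↭; ↭-empty-inv;
         ↭-singleton-inv; ¬x∷xs↭[]; drop-∷)
import Data.List.Relation.Binary.Permutation.Setoid as SetoidPerm
import Data.List.Relation.Binary.Permutation.Setoid.Properties as SetoidPermProps
open import Data.List.Relation.Binary.Pointwise using ([]; _∷_)
open import Data.List.Relation.Unary.Any using (here; there)
open import Data.List.Relation.Unary.Unique.Propositional using (Unique)
import Data.List.Relation.Unary.Unique.Propositional.Properties as UniqueP
open import Data.Nat.Base using (ℕ)
open import Data.Product.Base using (Σ; ∃; ∃₂; _×_; _,_; proj₁; swap)
open import Data.Sum.Base using (_⊎_; inj₁; inj₂)
open import Data.Unit.Base using (⊤)
open import Function.Base using (_∘_; id)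
open import Function.Bundles using (_⇔_; mk⇔; Equivalence)
open import Level using (Level)
open import Relation.Binary.Bundles using (Setoid)
open import Relation.Binary.PropositionalEquality
  using (_≡_; _≢_; refl; sym; trans; cong; cong₂; subst; setoid)
open import Relation.Nullary using (yes; no)

-- Inversion of permutations between nonempty lists.

module ConsInversion {c ℓ : Level} (S : Setoid c ℓ) where
  open Setoid S using (_≈_; Carrier)
  open SetoidPerm S using () renaming (_↭_ to _↭ₛ_)
  open SetoidPermProps S using (↭-split; ↭-shift)

  -- `↭-split` finds the element of `x ∷ xs` that matches `y`: it is either the head or lies behind
  -- it. The setoid is arbitrary because the inversion is needed for entries up to `≡` and for
  -- environments up to `↭`.
  ∷-inv : ∀ {x y : Carrier} {xs ys} → x ∷ xs ↭ₛ y ∷ ys →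
          (x ≈ y × xs ↭ₛ ys) ⊎ ∃ λ zs → xs ↭ₛ y ∷ zs × ys ↭ₛ x ∷ zs
  ∷-inv {y = y} {ys = ys} p with ↭-split y [] ys p
  ... | []     , qs , x≈y ∷ xs≋ , r = inj₁ (x≈y , Perm.trans (Perm.refl xs≋) r)
  ... | w ∷ ps , qs , x≈w ∷ xs≋ , r =
    inj₂ (ps ++ qs , Perm.trans (Perm.refl xs≋) (↭-shift ps qs) ,
          Perm.trans (SetoidPerm.↭-sym S r) (Perm.prep (Setoid.sym S x≈w) (SetoidPerm.↭-refl S)))

∷-inv-↭ : ∀ {X : Set} {x y : X} {xs ys} → x ∷ xs ↭ y ∷ ys →
          (x ≡ y × xs ↭ ys) ⊎ ∃ λ zs → xs ↭ y ∷ zs × ys ↭ x ∷ zs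
∷-inv-↭ {X} p with ConsInversion.∷-inv (setoid X) (↭.↭⇒↭ₛ p)
... | inj₁ (x≡y , q)    = inj₁ (x≡y , ↭.↭ₛ⇒↭ q)
... | inj₂ (zs , q , r) = inj₂ (zs , ↭.↭ₛ⇒↭ q , ↭.↭ₛ⇒↭ r)

module Erasure (N : Names) where
  open Names N
  open πLL N

  private variable
    n                 : ℕ
    x y z w x₁ x₂     : Name
    P P′ Q            : Proc n
    A B T U           : Ty n
    a b               : Act n
    l                 : Label n
    Γ Γ′ Δ Δ′ Θ       : Env n
    𝒢 𝒢′ ℋ ℋ′ 𝒦       : HEnv n

  -- Hyperenvironments up to `≋` and their names.

  ≋-refl : 𝒢 ≋ 𝒢
  ≋-refl = ≋-reflexive refl

  ≋-sym : 𝒢 ≋ ℋ → ℋ ≋ 𝒢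
  ≋-sym = Perm.sym ↭-sym

  module ≋-Properties {n : ℕ} = SetoidPermProps (↭.↭-setoid {A = Name × Ty n})

  infixr 4 _◅_
  _◅_ : 𝒢 ≋ ℋ → ℋ ≋ 𝒦 → 𝒢 ≋ 𝒦
  _◅_ = Perm.trans

  ≋-++ : 𝒢 ≋ 𝒢′ → ℋ ≋ ℋ′ → 𝒢 ++ ℋ ≋ 𝒢′ ++ ℋ′
  ≋-++ = ≋-Properties.++⁺

  ≋-++-comm : (𝒢 ℋ : HEnv n) → 𝒢 ++ ℋ ≋ ℋ ++ 𝒢
  ≋-++-comm = ≋-Properties.++-comm

  ≋-shift : ∀ (Γ : Env n) 𝒢 ℋ → 𝒢 ++ Γ ∷ ℋ ≋ Γ ∷ 𝒢 ++ ℋ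
  ≋-shift Γ 𝒢 ℋ = ≋-Properties.↭-shift 𝒢 ℋ

  ≋-swap : Γ ∷ Δ ∷ 𝒢 ≋ Δ ∷ Γ ∷ 𝒢
  ≋-swap = Perm.swap ↭-refl ↭-refl ≋-refl

  ≋-∷ : 𝒢 ≋ ℋ → Γ ∷ 𝒢 ≋ Γ ∷ ℋ
  ≋-∷ = Perm.prep ↭-refl

  ≋-∷-inv : Γ ∷ 𝒢 ≋ Δ ∷ ℋ → (Γ ↭ Δ × 𝒢 ≋ ℋ) ⊎ ∃ λ 𝒦 → 𝒢 ≋ Δ ∷ 𝒦 × ℋ ≋ Γ ∷ 𝒦
  ≋-∷-inv = ConsInversion.∷-inv ↭.↭-setoid

  names-∷ : (Γ : Env n) (𝒢 : HEnv n) → names (Γ ∷ 𝒢) ≡ dom Γ ++ names 𝒢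
  names-∷ Γ 𝒢 = map-++ proj₁ Γ (concat 𝒢)

  dom-↭ : Γ ↭ Δ → z ∈ dom Γ → z ∈ dom Δ
  dom-↭ p = ∈-resp-↭ (map⁺ proj₁ p)

  names-≋ : 𝒢 ≋ ℋ → z ∈ names 𝒢 → z ∈ names ℋ
  names-≋ e = ∈-resp-↭ (↭-names e)

  Unique-≋ : 𝒢 ≋ ℋ → Unique (names 𝒢) → Unique (names ℋ)
  Unique-≋ e = Unique-↭ (↭-names e)

  ∈-names-++ˡ : ∀ (𝒢 ℋ : HEnv n) → z ∈ names 𝒢 → z ∈ names (𝒢 ++ ℋ)
  ∈-names-++ˡ 𝒢 ℋ z∈ = subst (_ ∈_) (sym (names-++ 𝒢 ℋ)) (∈-++⁺ˡ z∈)

  ∈-names-++ʳ : ∀ (𝒢 ℋ : HEnv n) → z ∈ names ℋ → z ∈ names (𝒢 ++ ℋ)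
  ∈-names-++ʳ 𝒢 ℋ z∈ = subst (_ ∈_) (sym (names-++ 𝒢 ℋ)) (∈-++⁺ʳ (names 𝒢) z∈)

  ∈-names-++⁻ : ∀ (𝒢 ℋ : HEnv n) → z ∈ names (𝒢 ++ ℋ) → z ∈ names 𝒢 ⊎ z ∈ names ℋ
  ∈-names-++⁻ 𝒢 ℋ z∈ = ∈-++⁻ (names 𝒢) (subst (_ ∈_) (names-++ 𝒢 ℋ) z∈)

  -- Converse of `names⊆fn`: the typing rules record every free name. Together the two inclusions
  -- turn side conditions on free names into conditions on hyperenvironments, and back.
  fn⊆names : P ⊢ 𝒢 → z ∈ fn P → z ∈ names 𝒢
  fn⊆names (ax _) (here refl)         = here refl
  fn⊆names (ax _) (there (here refl)) = there (here refl)
  fn⊆names (cut {P = P} {x = x} {A = A} {Γ = Γ} {y = y} {Δ = Δ} {𝒢 = 𝒢} D) z∈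
    with z∈∖y , z≢x ← ∈-∖⁻ (fn P ∖ y) z∈
    with z∈P , z≢y ← ∈-∖⁻ (fn P) z∈∖y
    with ∈-resp-↭ (map⁺ proj₁ (merge-↭ (x , A) (y , dual A) Γ Δ (concat 𝒢))) (fn⊆names D z∈P)
  ... | here refl         = ⊥-elim (z≢x refl)
  ... | there (here refl) = ⊥-elim (z≢y refl)
  ... | there (there z∈′) = z∈′
  fn⊆names (mix {P = P} {𝒢 = 𝒢} {ℋ = ℋ} D E d) z∈ with ∈-++⁻ (fn P) z∈
  ... | inj₁ z∈P = ∈-names-++ˡ 𝒢 ℋ (fn⊆names D z∈P)
  ... | inj₂ z∈Q = ∈-names-++ʳ 𝒢 ℋ (fn⊆names E z∈Q)
  fn⊆names (tensor D) (here refl) = here refl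
  fn⊆names (tensor {P = P} {y = y} {A = A} {Γ = Γ} {x = x} {B = B} {Δ = Δ} D) (there z∈)
    with z∈P , z≢y ← ∈-∖⁻ (fn P) z∈
    with ∈-resp-↭ (map⁺ proj₁ (merge-↭ (y , A) (x , B) Γ Δ [])) (fn⊆names D z∈P)
  ... | here refl = ⊥-elim (z≢y refl)
  ... | there z∈′ = z∈′
  fn⊆names (one D) (here refl) = here refl
  fn⊆names (one D) (there z∈) with () ← fn⊆names D z∈
  fn⊆names (par D) (here refl) = here refl
  fn⊆names (par {P = P} D) (there z∈) with z∈P , z≢y ← ∈-∖⁻ (fn P) z∈ with fn⊆names D z∈P
  ... | here refl = ⊥-elim (z≢y refl)
  ... | there z∈′ = z∈′
  fn⊆names (bot D _) (here refl) = here refl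
  fn⊆names (bot D _) (there z∈)  = there (fn⊆names D z∈)
  fn⊆names (plus₁ D) (here refl) = here refl
  fn⊆names (plus₁ D) (there z∈)  = fn⊆names D z∈
  fn⊆names (plus₂ D) (here refl) = here refl
  fn⊆names (plus₂ D) (there z∈)  = fn⊆names D z∈
  fn⊆names (with& D E) (here refl) = here refl
  fn⊆names (with& {P = P} D E) (there z∈) with ∈-++⁻ (fn P) z∈
  ... | inj₁ z∈P = fn⊆names D z∈P
  ... | inj₂ z∈Q = fn⊆names E z∈Q
  fn⊆names (bang D _) (here refl) = here refl
  fn⊆names (bang {P = P} D _) (there z∈) with z∈P , z≢y ← ∈-∖⁻ (fn P) z∈ with fn⊆names D z∈P
  ... | here refl = ⊥-elim (z≢y refl)
  ... | there z∈′ = there z∈′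
  fn⊆names (quest D _) (here refl) = here refl
  fn⊆names (quest {P = P} D _) (there z∈) with z∈P , z≢y ← ∈-∖⁻ (fn P) z∈ with fn⊆names D z∈P
  ... | here refl = ⊥-elim (z≢y refl)
  ... | there z∈′ = there z∈′
  fn⊆names (weak D _) (here refl) = here refl
  fn⊆names (weak D _) (there z∈)  = there (fn⊆names D z∈)
  fn⊆names (contr D _) (here refl) = here refl
  fn⊆names (contr {P = P} {x₁ = x₁} {x₂ = x₂} D _) (there z∈)
    with z∈∖ , z≢x₁ ← ∈-∖⁻ (fn P ∖ x₂) z∈
    with z∈P , z≢x₂ ← ∈-∖⁻ (fn P) z∈∖
    with fn⊆names D z∈P
  ... | here refl         = ⊥-elim (z≢x₁ refl)
  ... | there (here refl) = ⊥-elim (z≢x₂ refl)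
  ... | there (there z∈′) = there z∈′
  fn⊆names (ex D) (here refl) = here refl
  fn⊆names (ex D) (there z∈)  = fn⊆names D z∈
  fn⊆names (all D) (here refl) = here refl
  fn⊆names (all {Γ = Γ} D) (there z∈) with fn⊆names D z∈
  ... | here refl = here refl
  ... | there z∈′ = there (subst (_ ∈_) (names-map₂ wk Γ) z∈′)
  fn⊆names (exch e D) z∈ = names-≋ e (fn⊆names D z∈)

  -- Typing is invariant under α-equivalence

  transpose-left : ∀ a b → transpose a b a ≡ b
  transpose-left a b with a ≟ a
  ... | yes _  = refl
  ... | no a≢a = ⊥-elim (a≢a refl)

  transpose-right : ∀ a b → transpose a b b ≡ a
  transpose-right a b with b ≟ a
  ... | yes b≡a = b≡a
  ... | no _ with b ≟ b
  ...   | yes _  = refl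
  ...   | no b≢b = ⊥-elim (b≢b refl)

  transpose-other : ∀ {a b c} → c ≢ a → c ≢ b → transpose a b c ≡ c
  transpose-other {a} {b} {c} c≢a c≢b with c ≟ a
  ... | yes c≡a = ⊥-elim (c≢a c≡a)
  ... | no _ with c ≟ b
  ...   | yes c≡b = ⊥-elim (c≢b c≡b)
  ...   | no _    = refl

  transpose-involutive : ∀ a b c → transpose a b (transpose a b c) ≡ c
  transpose-involutive a b c with c ≟ a
  ... | yes refl = transpose-right a b
  ... | no c≢a with c ≟ b
  ...   | yes refl = transpose-left a b
  ...   | no c≢b   = transpose-other c≢a c≢b

  transpose-injective : ∀ a b {c d} → transpose a b c ≡ transpose a b d → c ≡ d
  transpose-injective a b {c} {d} eq =
    trans (sym (transpose-involutive a b c)) (trans (cong (transpose a b) eq) (transpose-involutive a b d))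

  swap-involutive : ∀ a b (P : Proc n) → ⦅ a ↔ b ⦆· (⦅ a ↔ b ⦆· P) ≡ P
  swap-involutive a b (out x y P)
    rewrite transpose-involutive a b x | transpose-involutive a b y | swap-involutive a b P = refl
  swap-involutive a b (inp x y P)
    rewrite transpose-involutive a b x | transpose-involutive a b y | swap-involutive a b P = refl
  swap-involutive a b (close x P)   = cong₂ close (transpose-involutive a b x) (swap-involutive a b P)
  swap-involutive a b (wait x P)    = cong₂ wait (transpose-involutive a b x) (swap-involutive a b P)
  swap-involutive a b (inl x P)     = cong₂ inl (transpose-involutive a b x) (swap-involutive a b P)
  swap-involutive a b (inr x P)     = cong₂ inr (transpose-involutive a b x) (swap-involutive a b P)
  swap-involutive a b (case x P Q)
    rewrite transpose-involutive a b x | swap-involutive a b P | swap-involutive a b Q = refl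
  swap-involutive a b (outT x A P)  =
    cong₂ (λ x → outT x A) (transpose-involutive a b x) (swap-involutive a b P)
  swap-involutive a b (inpT x P)    = cong₂ inpT (transpose-involutive a b x) (swap-involutive a b P)
  swap-involutive a b (serve x y P)
    rewrite transpose-involutive a b x | transpose-involutive a b y | swap-involutive a b P = refl
  swap-involutive a b (use x y P)
    rewrite transpose-involutive a b x | transpose-involutive a b y | swap-involutive a b P = refl
  swap-involutive a b (dup x x₁ x₂ P)
    rewrite transpose-involutive a b x | transpose-involutive a b x₁ | transpose-involutive a b x₂
          | swap-involutive a b P = refl
  swap-involutive a b (drop x P)    = cong₂ drop (transpose-involutive a b x) (swap-involutive a b P)
  swap-involutive a b (ν x y P)
    rewrite transpose-involutive a b x | transpose-involutive a b y | swap-involutive a b P = refl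
  swap-involutive a b (P ∥ Q)       = cong₂ _∥_ (swap-involutive a b P) (swap-involutive a b Q)
  swap-involutive a b 𝟘             = refl
  swap-involutive a b (link x y)    = cong₂ link (transpose-involutive a b x) (transpose-involutive a b y)

  ∉-transpose : ∀ a b (Γ : Env n) → x ∉ dom Γ → transpose a b x ∉ dom (renᵉ (transpose a b) Γ)
  ∉-transpose a b Γ x∉ p
    with c , c∈ , eq ← ∈-map⁻ (transpose a b) (subst (_ ∈_) (dom-renᵉ (transpose a b) Γ) p)
    with refl ← transpose-injective a b eq = x∉ c∈

  -- A transposition is injective on all names and acts on bound names too, so each rule is mapped
  -- to itself without any choice of fresh names, in contrast to `renD`.
  swapD : ∀ a b → P ⊢ 𝒢 → ⦅ a ↔ b ⦆· P ⊢ renʰ (transpose a b) 𝒢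
  swapD a b (ax x≢y) = ax (x≢y ∘ transpose-injective a b)
  swapD a b (cut {Γ = Γ} {Δ = Δ} {𝒢 = 𝒢} D) =
    recast (cong (_∷ renʰ (transpose a b) 𝒢) (sym (map-++ _ Γ Δ))) (cut (swapD a b D))
  swapD a b (mix {𝒢 = 𝒢} {ℋ = ℋ} D E d) =
    recast (sym (map-++ _ 𝒢 ℋ)) (mix (swapD a b D) (swapD a b E) apart)
    where
    ρ = transpose a b
    apart : Disjoint (names (renʰ ρ 𝒢)) (names (renʰ ρ ℋ))
    apart (p , q)
      with c , c∈ , refl ← ∈-map⁻ ρ (subst (_ ∈_) (names-renʰ ρ 𝒢) p)
         | d′ , d∈ , eq  ← ∈-map⁻ ρ (subst (_ ∈_) (names-renʰ ρ ℋ) q)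
      with refl ← transpose-injective a b eq = d (c∈ , d∈)
  swapD a b mix₀ = mix₀
  swapD a b (tensor {Γ = Γ} {Δ = Δ} D) =
    recast (cong (λ Θ → [ _ ∷ Θ ]) (sym (map-++ _ Γ Δ))) (tensor (swapD a b D))
  swapD a b (one D) = one (swapD a b D)
  swapD a b (par D) = par (swapD a b D)
  swapD a b (bot {Γ = Γ} D x∉) = bot (swapD a b D) (∉-transpose a b Γ x∉)
  swapD a b (plus₁ D) = plus₁ (swapD a b D)
  swapD a b (plus₂ D) = plus₂ (swapD a b D)
  swapD a b (with& D E) = with& (swapD a b D) (swapD a b E)
  swapD a b (bang {Γ = Γ} D x∉) =
    recast (cong (λ Θ → [ _ ∷ Θ ]) (sym (renᵉ-？ _ Γ)))
      (bang (recast (cong (λ Θ → [ _ ∷ Θ ]) (renᵉ-？ _ Γ)) (swapD a b D)) (∉-transpose a b Γ x∉))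
  swapD a b (quest {Γ = Γ} D x∉) = quest (swapD a b D) (∉-transpose a b Γ x∉)
  swapD a b (weak {Γ = Γ} D x∉) = weak (swapD a b D) (∉-transpose a b Γ x∉)
  swapD a b (contr {Γ = Γ} D x∉) = contr (swapD a b D) (∉-transpose a b Γ x∉)
  swapD a b (ex D) = ex (swapD a b D)
  swapD a b (all {Γ = Γ} D) = all (recast (cong (λ Θ → [ _ ∷ Θ ]) (renᵉ-wk _ Γ)) (swapD a b D))
  swapD a b (exch e D) = exch (≋-map (map⁺ _) e) (swapD a b D)

  renᵉ-fixed : ∀ {ρ} (Γ : Env n) → (∀ {z} → z ∈ dom Γ → ρ z ≡ z) → renᵉ ρ Γ ≡ Γ
  renᵉ-fixed []            fix = refl
  renᵉ-fixed ((z , A) ∷ Γ) fix = cong₂ _∷_ (cong (_, A) (fix (here refl))) (renᵉ-fixed Γ (fix ∘ there))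

  renʰ-fixed : ∀ {ρ} (𝒢 : HEnv n) → (∀ {z} → z ∈ names 𝒢 → ρ z ≡ z) → renʰ ρ 𝒢 ≡ 𝒢
  renʰ-fixed []      fix = refl
  renʰ-fixed (Γ ∷ 𝒢) fix =
    cong₂ _∷_ (renᵉ-fixed Γ (fix ∘ subst (_ ∈_) (sym (names-∷ Γ 𝒢)) ∘ ∈-++⁺ˡ))
              (renʰ-fixed 𝒢 (fix ∘ subst (_ ∈_) (sym (names-∷ Γ 𝒢)) ∘ ∈-++⁺ʳ (dom Γ)))

  renʰ-head : ∀ {ρ c d} → ρ c ≡ d → (Γ : Env n) (𝒢 : HEnv n) →
              (∀ {z} → z ∈ names (Γ ∷ 𝒢) → ρ z ≡ z) →
              renʰ ρ (((c , A) ∷ Γ) ∷ 𝒢) ≡ ((d , A) ∷ Γ) ∷ 𝒢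
  renʰ-head {A = A} refl Γ 𝒢 fix =
    -- The clause for `[]` only makes the function total; both sides of the equation are nonempty.
    cong (λ { (Γ ∷ 𝒢) → ((_ , A) ∷ Γ) ∷ 𝒢 ; [] → [] }) (renʰ-fixed (Γ ∷ 𝒢) fix)

  -- The remaining names differ from `y` by distinctness and from `w` because they are free in `P`,
  -- so the transposition fixes them.
  rename⁺ : P ⊢ ((y , A) ∷ Γ) ∷ 𝒢 → w ∉ fn P → ⦅ y ↔ w ⦆· P ⊢ ((w , A) ∷ Γ) ∷ 𝒢
  rename⁺ {y = y} {Γ = Γ} {𝒢 = 𝒢} {w = w} D w∉ =
    recast (renʰ-head (transpose-left y w) Γ 𝒢
             (λ z∈ → transpose-other (∈⇒≢ z∈ (head∉ (distinct D))) (∈⇒≢ (names⊆fn D (there z∈)) w∉)))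
           (swapD y w D)

  -- The transposition is undone by applying it again. It fixes the remaining names: if `y` were one
  -- of them, its image `w` would be a name of the derivation `E`, hence free in `P`.
  rename⁻ : ⦅ y ↔ w ⦆· P ⊢ ((w , A) ∷ Γ) ∷ 𝒢 → w ∉ fn P → P ⊢ ((y , A) ∷ Γ) ∷ 𝒢
  rename⁻ {y = y} {w = w} {P = P} {A = A} {Γ = Γ} {𝒢 = 𝒢} D w∉ =
    recast (renʰ-head (transpose-right y w) Γ 𝒢 (λ z∈ → transpose-other (z≢y z∈) (∈⇒≢ z∈ (head∉ (distinct D))))) E
    where
    E : P ⊢ renʰ (transpose y w) (((w , A) ∷ Γ) ∷ 𝒢)
    E = subst (_⊢ _) (swap-involutive y w P) (swapD y w D)
    z≢y : z ∈ names (Γ ∷ 𝒢) → z ≢ y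
    z≢y z∈ refl = w∉ (subst (_∈ fn P) (transpose-left y w) (names⊆fn E
      (subst (transpose y w y ∈_) (sym (names-renʰ (transpose y w) (((w , A) ∷ Γ) ∷ 𝒢)))
             (∈-map⁺ (transpose y w) (there z∈)))))

  exch-head : P ⊢ [ (x , A) ∷ (y , B) ∷ Γ ] → P ⊢ [ (y , B) ∷ (x , A) ∷ Γ ]
  exch-head = exch (Perm.prep (↭.swap _ _ ↭-refl) ≋-refl)

  cut-swap : P ⊢ ((x , A) ∷ Γ) ∷ ((y , dual A) ∷ Δ) ∷ 𝒢 → ν y x P ⊢ (Γ ++ Δ) ∷ 𝒢
  cut-swap {x = x} {A = A} {Γ = Γ} {Δ = Δ} D =
    exch (Perm.prep (++-comm Δ Γ) ≋-refl)
      (cut (exch (≋-swap ◅ ≋-∷ (≋-reflexive (cong (λ B → ((x , B) ∷ Γ) ∷ _) (sym (dual-involutive A))))) D))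

  -- The two directions are mutually recursive because `α-sym` reverses the direction. Removing
  -- `exch` first leaves a derivation whose last rule is determined by the process constructor.
  ⊢-resp-α  : P =α Q → P ⊢ 𝒢 → Q ⊢ 𝒢
  ⊢-resp-α˘ : P =α Q → Q ⊢ 𝒢 → P ⊢ 𝒢

  ⊢-resp-α p (exch e D) = exch e (⊢-resp-α p D)
  ⊢-resp-α α-refl D = D
  ⊢-resp-α (α-sym p) D = ⊢-resp-α˘ p D
  ⊢-resp-α (α-trans p q) D = ⊢-resp-α q (⊢-resp-α p D)
  ⊢-resp-α (α-out w∉) (tensor D) = tensor (rename⁺ D w∉)
  ⊢-resp-α (α-inp w∉) (par D) = par (rename⁺ D w∉)
  ⊢-resp-α (α-serve w∉) (bang D x∉) = bang (rename⁺ D w∉) x∉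
  ⊢-resp-α (α-use w∉) (quest D x∉) = quest (rename⁺ D w∉) x∉
  ⊢-resp-α (α-dup₁ _ _ w∉) (contr D x∉) = contr (rename⁺ D w∉) x∉
  -- `rename⁺` acts on the first entry, so the second bound name is brought to the front and moved
  -- back.
  ⊢-resp-α (α-dup₂ _ _ w∉) (contr D x∉) = contr (exch-head (rename⁺ (exch-head D) w∉)) x∉
  ⊢-resp-α (α-ν _ _ w∉) (cut D) = cut (rename⁺ D w∉)
  ⊢-resp-α ν-swap (cut D) = cut-swap D
  ⊢-resp-α (out-cong p) (tensor D) = tensor (⊢-resp-α p D)
  ⊢-resp-α (inp-cong p) (par D) = par (⊢-resp-α p D)
  ⊢-resp-α (close-cong p) (one D) = one (⊢-resp-α p D)
  ⊢-resp-α (wait-cong p) (bot D x∉) = bot (⊢-resp-α p D) x∉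
  ⊢-resp-α (inl-cong p) (plus₁ D) = plus₁ (⊢-resp-α p D)
  ⊢-resp-α (inr-cong p) (plus₂ D) = plus₂ (⊢-resp-α p D)
  ⊢-resp-α (case-cong p q) (with& D E) = with& (⊢-resp-α p D) (⊢-resp-α q E)
  ⊢-resp-α (outT-cong p) (ex D) = ex (⊢-resp-α p D)
  ⊢-resp-α (inpT-cong p) (all D) = all (⊢-resp-α p D)
  ⊢-resp-α (serve-cong p) (bang D x∉) = bang (⊢-resp-α p D) x∉
  ⊢-resp-α (use-cong p) (quest D x∉) = quest (⊢-resp-α p D) x∉
  ⊢-resp-α (dup-cong p) (contr D x∉) = contr (⊢-resp-α p D) x∉
  ⊢-resp-α (drop-cong p) (weak D x∉) = weak (⊢-resp-α p D) x∉
  ⊢-resp-α (ν-cong p) (cut D) = cut (⊢-resp-α p D)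
  ⊢-resp-α (∥-cong p q) (mix D E d) = mix (⊢-resp-α p D) (⊢-resp-α q E) d

  ⊢-resp-α˘ p (exch e D) = exch e (⊢-resp-α˘ p D)
  ⊢-resp-α˘ α-refl D = D
  ⊢-resp-α˘ (α-sym p) D = ⊢-resp-α p D
  ⊢-resp-α˘ (α-trans p q) D = ⊢-resp-α˘ p (⊢-resp-α˘ q D)
  ⊢-resp-α˘ (α-out w∉) (tensor D) = tensor (rename⁻ D w∉)
  ⊢-resp-α˘ (α-inp w∉) (par D) = par (rename⁻ D w∉)
  ⊢-resp-α˘ (α-serve w∉) (bang D x∉) = bang (rename⁻ D w∉) x∉
  ⊢-resp-α˘ (α-use w∉) (quest D x∉) = quest (rename⁻ D w∉) x∉
  ⊢-resp-α˘ (α-dup₁ _ _ w∉) (contr D x∉) = contr (rename⁻ D w∉) x∉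
  ⊢-resp-α˘ (α-dup₂ _ _ w∉) (contr D x∉) = contr (exch-head (rename⁻ (exch-head D) w∉)) x∉
  ⊢-resp-α˘ (α-ν _ _ w∉) (cut D) = cut (rename⁻ D w∉)
  ⊢-resp-α˘ ν-swap (cut D) = cut-swap D
  ⊢-resp-α˘ (out-cong p) (tensor D) = tensor (⊢-resp-α˘ p D)
  ⊢-resp-α˘ (inp-cong p) (par D) = par (⊢-resp-α˘ p D)
  ⊢-resp-α˘ (close-cong p) (one D) = one (⊢-resp-α˘ p D)
  ⊢-resp-α˘ (wait-cong p) (bot D x∉) = bot (⊢-resp-α˘ p D) x∉
  ⊢-resp-α˘ (inl-cong p) (plus₁ D) = plus₁ (⊢-resp-α˘ p D)
  ⊢-resp-α˘ (inr-cong p) (plus₂ D) = plus₂ (⊢-resp-α˘ p D)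
  ⊢-resp-α˘ (case-cong p q) (with& D E) = with& (⊢-resp-α˘ p D) (⊢-resp-α˘ q E)
  ⊢-resp-α˘ (outT-cong p) (ex D) = ex (⊢-resp-α˘ p D)
  ⊢-resp-α˘ (inpT-cong p) (all D) = all (⊢-resp-α˘ p D)
  ⊢-resp-α˘ (serve-cong p) (bang D x∉) = bang (⊢-resp-α˘ p D) x∉
  ⊢-resp-α˘ (use-cong p) (quest D x∉) = quest (⊢-resp-α˘ p D) x∉
  ⊢-resp-α˘ (dup-cong p) (contr D x∉) = contr (⊢-resp-α˘ p D) x∉
  ⊢-resp-α˘ (drop-cong p) (weak D x∉) = weak (⊢-resp-α˘ p D) x∉
  ⊢-resp-α˘ (ν-cong p) (cut D) = cut (⊢-resp-α˘ p D)
  ⊢-resp-α˘ (∥-cong p q) (mix D E d) = mix (⊢-resp-α˘ p D) (⊢-resp-α˘ q E) d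

  -- The effect of a transition on the hyperenvironment

  subject : Act n → Name
  subject (close x)       = x
  subject (wait x)        = x
  subject (out x y)       = x
  subject (inp x y)       = x
  subject (inl x)         = x
  subject (coinl x)       = x
  subject (inr x)         = x
  subject (coinr x)       = x
  subject (use x y)       = x
  subject (serve x y)     = x
  subject (dup x x₁ x₂)   = x
  subject (codup x x₁ x₂) = x
  subject (drop x)        = x
  subject (codrop x)      = x
  subject (outT x A)      = x
  subject (inpT x A)      = x

  subject∈ : (a : Act n) → subject a ∈ fnᵃ a
  subject∈ (close x)       = here refl
  subject∈ (wait x)        = here refl
  subject∈ (out x y)       = here refl
  subject∈ (inp x y)       = here refl
  subject∈ (inl x)         = here refl
  subject∈ (coinl x)       = here refl
  subject∈ (inr x)         = here refl
  subject∈ (coinr x)       = here refl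
  subject∈ (use x y)       = here refl
  subject∈ (serve x y)     = here refl
  subject∈ (dup x x₁ x₂)   = here refl
  subject∈ (codup x x₁ x₂) = here refl
  subject∈ (drop x)        = here refl
  subject∈ (codrop x)      = here refl
  subject∈ (outT x A)      = here refl
  subject∈ (inpT x A)      = here refl

  -- T is the type of the subject of the action, and Θ lists the entries that
  -- take its place in the same environment.
  data Replace {n : ℕ} : Act n → Ty n → Env n → Set where
    inp    : Replace (inp x y) (A ⅋ B) ((y , A) ∷ (x , B) ∷ [])
    wait   : Replace (wait x) ⊥̇ []
    inl    : Replace (inl x) (A ⊕ B) [ (x , A) ]
    inr    : Replace (inr x) (A ⊕ B) [ (x , B) ]
    coinl  : Replace (coinl x) (A & B) [ (x , A) ]
    coinr  : Replace (coinr x) (A & B) [ (x , B) ]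
    use    : Replace (use x y) (？ A) [ (y , A) ]
    serve  : Replace (serve x y) (！ A) [ (y , A) ]
    dup    : Replace (dup x x₁ x₂) (？ A) [ (x₁ , ？ A ⅋ ？ A) ]
    codup  : Replace (codup x x₁ x₂) (！ A) [ (x₁ , ！ A ⊗ ！ A) ]
    drop   : Replace (drop x) (？ A) [ (x , ⊥̇) ]
    codrop : Replace (codrop x) (！ A) [ (x , 𝟏) ]
    outT   : Replace (outT x A) (‵∃ B) [ (x , B [ A ]ᵗ) ]
    inpT   : Replace (inpT x A) (‵∀ B) [ (x , B [ A ]ᵗ) ]

  data Local {n : ℕ} : Label n → Env n → HEnv n → Set where
    out     : Local (act (out x y)) ((x , A ⊗ B) ∷ Γ ++ Δ) (((y , A) ∷ Γ) ∷ ((x , B) ∷ Δ) ∷ [])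
    close   : Local (act (close x)) [ (x , 𝟏) ] []
    link    : Local (link x y) ((x , dual A) ∷ (y , A) ∷ []) []
    replace : Replace a T Θ → Local (act a) ((subject a , T) ∷ Γ) [ Θ ++ Γ ]

  record Step (l : Label n) (𝒢 𝒢′ : HEnv n) : Set where
    constructor step
    field
      {redex}   : Env n
      {reduct}  : HEnv n
      {context} : HEnv n
      local     : Local l redex reduct
      source    : 𝒢 ≋ redex ∷ context
      target    : 𝒢′ ≋ reduct ++ context

  -- The uniqueness has to be recorded because the intermediate hyperenvironment
  -- need not type any process that occurs in the transition.
  Steps : Act n → Act n → HEnv n → HEnv n → Set
  Steps a b 𝒢 𝒢′ = ∃ λ 𝒢₁ → Unique (names 𝒢₁) × Step (act a) 𝒢 𝒢₁ × Step (act b) 𝒢₁ 𝒢′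

  -- Both orders occur at `pair` so that the effect is invariant under `flip`.
  Effect : Label n → HEnv n → HEnv n → Set
  Effect τ          𝒢 𝒢′ = 𝒢 ≋ 𝒢′
  Effect (link x y) 𝒢 𝒢′ = Step (link x y) 𝒢 𝒢′
  Effect (act a)    𝒢 𝒢′ = Step (act a) 𝒢 𝒢′
  Effect (pair a b) 𝒢 𝒢′ = Steps a b 𝒢 𝒢′ × Steps b a 𝒢 𝒢′

  step-resp-≋ : 𝒢 ≋ ℋ → 𝒢′ ≋ ℋ′ → Step l ℋ ℋ′ → Step l 𝒢 𝒢′
  step-resp-≋ e e′ (step c s t) = step c (e ◅ s) (e′ ◅ t)

  steps-resp-≋ : 𝒢 ≋ ℋ → 𝒢′ ≋ ℋ′ → Steps a b ℋ ℋ′ → Steps a b 𝒢 𝒢′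
  steps-resp-≋ e e′ (𝒢₁ , u , s , t) = 𝒢₁ , u , step-resp-≋ e ≋-refl s , step-resp-≋ ≋-refl e′ t

  effect-resp-≋ : ∀ l → 𝒢 ≋ ℋ → 𝒢′ ≋ ℋ′ → Effect l ℋ ℋ′ → Effect l 𝒢 𝒢′
  effect-resp-≋ τ          e e′ f       = e ◅ f ◅ ≋-sym e′
  effect-resp-≋ (link x y) e e′ f       = step-resp-≋ e e′ f
  effect-resp-≋ (act a)    e e′ f       = step-resp-≋ e e′ f
  effect-resp-≋ (pair a b) e e′ (f , g) = steps-resp-≋ e e′ f , steps-resp-≋ e e′ g

  replace-names : Replace a T Θ → z ∈ dom Θ → z ≡ subject a ⊎ z ∈ bnᵃ a
  replace-names inp    (here p)         = inj₂ (here p)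
  replace-names inp    (there (here p)) = inj₁ p
  replace-names inl    (here p)         = inj₁ p
  replace-names inr    (here p)         = inj₁ p
  replace-names coinl  (here p)         = inj₁ p
  replace-names coinr  (here p)         = inj₁ p
  replace-names use    (here p)         = inj₂ (here p)
  replace-names serve  (here p)         = inj₂ (here p)
  replace-names dup    (here p)         = inj₂ (here p)
  replace-names codup  (here p)         = inj₂ (here p)
  replace-names drop   (here p)         = inj₁ p
  replace-names codrop (here p)         = inj₁ p
  replace-names outT   (here p)         = inj₁ p
  replace-names inpT   (here p)         = inj₁ p

  local-names : Local l Γ 𝒦 → z ∈ names 𝒦 → z ∈ dom Γ ⊎ z ∈ bnˡ l
  local-names (out {Γ = Γ} {Δ = Δ}) (here p) = inj₂ (here p)
  local-names {z = z} (out {x = x} {y = y} {A = A} {B = B} {Γ = Γ} {Δ = Δ}) (there z∈)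
    with ∈-resp-↭ (map⁺ proj₁ (merge-↭ (y , A) (x , B) Γ Δ [])) (there z∈)
  ... | here p    = inj₂ (here p)
  ... | there z∈′ = inj₁ (subst (z ∈_) (names-[] ((x , B) ∷ Γ ++ Δ)) z∈′)
  local-names {z = z} (replace {a = a} {Θ = Θ} {Γ = Γ} r) z∈
    with ∈-++⁻ (dom Θ) (subst (z ∈_) (trans (names-[] (Θ ++ Γ)) (map-++ proj₁ Θ Γ)) z∈)
  ... | inj₂ z∈Γ = inj₁ (there z∈Γ)
  ... | inj₁ z∈Θ with replace-names r z∈Θ
  ...   | inj₁ z≡ = inj₁ (here z≡)
  ...   | inj₂ z∈ = inj₂ z∈

  step-names : Step l 𝒢 𝒢′ → z ∈ names 𝒢′ → z ∈ names 𝒢 ⊎ z ∈ bnˡ l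
  step-names (step {Γ} {𝒦} {ℋ} c s t) z∈ with ∈-names-++⁻ 𝒦 ℋ (names-≋ t z∈)
  ... | inj₂ z∈ℋ = inj₁ (names-≋ (≋-sym s) (∈-names-++ʳ [ Γ ] ℋ z∈ℋ))
  ... | inj₁ z∈𝒦 with local-names c z∈𝒦
  ...   | inj₁ z∈Γ = inj₁ (names-≋ (≋-sym s) (∈-names-++ˡ [ Γ ] ℋ (dom⊆ Γ z∈Γ)))
  ...   | inj₂ z∈l = inj₂ z∈l

  -- This keeps the two components of a parallel composition disjoint after one of them has moved.
  effect-names : ∀ l → Effect l 𝒢 𝒢′ → z ∈ names 𝒢′ → z ∈ names 𝒢 ⊎ z ∈ bnˡ l
  effect-names τ          e z∈ = inj₁ (names-≋ (≋-sym e) z∈)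
  effect-names (link x y) s z∈ = step-names s z∈
  effect-names (act a)    s z∈ = step-names s z∈
  effect-names (pair a b) ((_ , _ , s , t) , _) z∈ with step-names t z∈
  ... | inj₂ z∈b = inj₂ (∈-++⁺ʳ (bnᵃ a) z∈b)
  ... | inj₁ z∈₁ with step-names s z∈₁
  ...   | inj₁ z∈𝒢 = inj₁ z∈𝒢
  ...   | inj₂ z∈a = inj₂ (∈-++⁺ˡ z∈a)

  -- Effects beside a parallel component.

  step-++ : ∀ (ℋ : HEnv n) → Step l 𝒢 𝒢′ → Step l (𝒢 ++ ℋ) (𝒢′ ++ ℋ)
  step-++ ℋ (step {_} {𝒦} {𝒳} c s t) =
    step c (≋-++ s ≋-refl) (≋-++ t ≋-refl ◅ ≋-reflexive (++-assoc 𝒦 𝒳 ℋ))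

  Unique-++ : (𝒢 : HEnv n) → Unique (names 𝒢) → Unique (names ℋ) → Disjoint (names 𝒢) (names ℋ) →
              Unique (names (𝒢 ++ ℋ))
  Unique-++ {ℋ = ℋ} 𝒢 u v d = subst Unique (sym (names-++ 𝒢 ℋ)) (UniqueP.++⁺ u v d)

  steps-++ : ∀ (ℋ : HEnv n) → Unique (names ℋ) → Disjoint (names 𝒢) (names ℋ) → Disjoint (bnᵃ a) (names ℋ) →
             Steps a b 𝒢 𝒢′ → Steps a b (𝒢 ++ ℋ) (𝒢′ ++ ℋ)
  steps-++ ℋ v d d′ (𝒢₁ , u , s , t) =
    𝒢₁ ++ ℋ , Unique-++ 𝒢₁ u v d₁ , step-++ ℋ s , step-++ ℋ t
    where
    d₁ : Disjoint (names 𝒢₁) (names ℋ)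
    d₁ (z∈₁ , z∈ℋ) with step-names s z∈₁
    ... | inj₁ z∈𝒢 = d (z∈𝒢 , z∈ℋ)
    ... | inj₂ z∈a = d′ (z∈a , z∈ℋ)

  effect-++ : ∀ l (ℋ : HEnv n) → Unique (names ℋ) → Disjoint (names 𝒢) (names ℋ) →
              Disjoint (bnˡ l) (names ℋ) → Effect l 𝒢 𝒢′ → Effect l (𝒢 ++ ℋ) (𝒢′ ++ ℋ)
  effect-++ τ          ℋ v d d′ e       = ≋-++ e ≋-refl
  effect-++ (link x y) ℋ v d d′ s       = step-++ ℋ s
  effect-++ (act a)    ℋ v d d′ s       = step-++ ℋ s
  effect-++ (pair a b) ℋ v d d′ (s , t) =
    steps-++ ℋ v d (λ (p , q) → d′ (∈-++⁺ˡ p , q)) s ,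
    steps-++ ℋ v d (λ (p , q) → d′ (∈-++⁺ʳ (bnᵃ a) p , q)) t

  -- Effects below a cut.

  ++-extract : ∀ {X : Set} {c : X} xs {ys zs} → xs ++ ys ↭ c ∷ zs →
               (∃ λ xs′ → xs ↭ c ∷ xs′ × zs ↭ xs′ ++ ys) ⊎ (∃ λ ys′ → ys ↭ c ∷ ys′ × zs ↭ xs ++ ys′)
  ++-extract {c = c} xs {ys} p with ∈-++⁻ xs (∈-resp-↭ (↭-sym p) (here refl))
  ... | inj₁ c∈ with as , bs , refl ← ∈-∃++ c∈ =
    inj₁ (as ++ bs , shift c as bs , drop-∷ (↭-trans (↭-sym p) (++⁺ʳ ys (shift c as bs))))
  ... | inj₂ c∈ with as , bs , refl ← ∈-∃++ c∈ =
    inj₂ (as ++ bs , shift c as bs ,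
          drop-∷ (↭-trans (↭-sym p) (↭-trans (++⁺ˡ xs (shift c as bs)) (shift c xs (as ++ bs)))))

  -- The entry c, untouched by the step, ends up with the entries Λ, and the
  -- step is still possible after c is cut, which replaces c by entries Δ.
  Frame : Label n → Name × Ty n → Env n → HEnv n → Set
  Frame l c Γ 𝒦 = ∃₂ λ Λ 𝒦₀ → 𝒦 ≋ (c ∷ Λ) ∷ 𝒦₀ ×
    (∀ Δ → ∃₂ λ Γ₁ 𝒦₁ → Local l Γ₁ 𝒦₁ × Γ ++ Δ ↭ Γ₁ × (Λ ++ Δ) ∷ 𝒦₀ ≋ 𝒦₁)

  -- Every entry of a `close` or `link` redex is named in the label, so these cases are impossible.
  -- `replace` leaves other entries in place, and `out` sends the entry into one of its two
  -- environments, where additional entries `Δ` can follow it.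
  local-frame : Local l Γ 𝒦 → Γ ↭ (x , T) ∷ Γ′ → x ∉ fnˡ l → Frame l (x , T) Γ′ 𝒦
  local-frame close p x∉ with ∷-inv-↭ p
  ... | inj₁ (refl , _)  = ⊥-elim (x∉ (here refl))
  ... | inj₂ (_ , q , _) = ⊥-elim (¬x∷xs↭[] (↭-sym q))
  local-frame link p x∉ with ∷-inv-↭ p
  ... | inj₁ (refl , _)  = ⊥-elim (x∉ (here refl))
  ... | inj₂ (_ , q , _) with refl ← ↭-singleton-inv (↭-sym q) = ⊥-elim (x∉ (there (here refl)))
  local-frame {x = x} {T = T} (replace {a = a} {T = U} {Θ = Θ} r) p x∉ with ∷-inv-↭ p
  ... | inj₁ (refl , _)   = ⊥-elim (x∉ (subject∈ a))
  ... | inj₂ (Λ , q , q′) =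
    Θ ++ Λ , [] , Perm.prep (↭-trans (++⁺ˡ Θ q) (shift (x , T) Θ Λ)) ≋-refl ,
    λ Δ → (subject a , U) ∷ Λ ++ Δ , [ Θ ++ Λ ++ Δ ] , replace r , ++⁺ʳ Δ q′ ,
          ≋-reflexive (cong [_] (++-assoc Θ Λ Δ))
  local-frame (out {x = s} {y = y} {A = A} {B = B} {Γ = Γa} {Δ = Γb}) p x∉ with ∷-inv-↭ p
  ... | inj₁ (refl , _)   = ⊥-elim (x∉ (here refl))
  ... | inj₂ (Λ , q , q′) with ++-extract Γa q
  ...   | inj₁ (Γa′ , r , r′) =
    (y , A) ∷ Γa′ , [ (s , B) ∷ Γb ] ,
    Perm.prep (↭-trans (↭.prep _ r) (↭.swap _ _ ↭-refl)) ≋-refl ,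
    λ Δ → (s , A ⊗ B) ∷ (Γa′ ++ Δ) ++ Γb , ((y , A) ∷ Γa′ ++ Δ) ∷ ((s , B) ∷ Γb) ∷ [] , out ,
          ↭-trans (++⁺ʳ Δ q′) (↭.prep _ (↭-trans (++⁺ʳ Δ r′) (move Δ))) , ≋-refl
    where
    move : ∀ Δ → (Γa′ ++ Γb) ++ Δ ↭ (Γa′ ++ Δ) ++ Γb
    move Δ = ↭-trans (↭-reflexive (++-assoc Γa′ Γb Δ))
               (↭-trans (++⁺ˡ Γa′ (++-comm Γb Δ)) (↭-reflexive (sym (++-assoc Γa′ Δ Γb))))
  ...   | inj₂ (Γb′ , r , r′) =
    (s , B) ∷ Γb′ , [ (y , A) ∷ Γa ] ,
    (≋-swap ◅ Perm.prep (↭-trans (↭.prep _ r) (↭.swap _ _ ↭-refl)) ≋-refl) ,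
    λ Δ → (s , A ⊗ B) ∷ Γa ++ Γb′ ++ Δ , ((y , A) ∷ Γa) ∷ ((s , B) ∷ Γb′ ++ Δ) ∷ [] , out ,
          ↭-trans (++⁺ʳ Δ q′) (↭.prep _ (↭-trans (++⁺ʳ Δ r′) (↭-reflexive (++-assoc Γa Γb′ Δ)))) , ≋-swap

  -- Here `𝒢` is the source after the cut and `𝒢′` the target before it: the endpoints remain in
  -- separate environments, and `E` survives the cut.
  CutTarget : (HEnv n → HEnv n → Set) → Name × Ty n → Name × Ty n → HEnv n → HEnv n → Set
  CutTarget E c d 𝒢 𝒢′ = ∃₂ λ Γ Δ → ∃ λ ℋ → 𝒢′ ≋ (c ∷ Γ) ∷ (d ∷ Δ) ∷ ℋ × E 𝒢 ((Γ ++ Δ) ∷ ℋ)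

  -- The redex is the environment of `x`, that of `y`, or neither. In the first two cases
  -- `local-frame` lets the redex absorb the entries of the other endpoint; in the third the cut
  -- happens entirely in the context.
  cut-step : x ∉ fnˡ l → y ∉ fnˡ l → Step l (((x , A) ∷ Γ) ∷ ((y , B) ∷ Δ) ∷ ℋ) 𝒢′ →
             CutTarget (Step l) (x , A) (y , B) ((Γ ++ Δ) ∷ ℋ) 𝒢′
  cut-step {Γ = Γ} {Δ = Δ} {ℋ = ℋ} x∉ y∉ (step {Γ₀} {𝒦} {ℳ} c s t) with ≋-∷-inv s
  ... | inj₁ (p , q) with Λ , 𝒦₀ , k , f ← local-frame c (↭-sym p) x∉
                     with Γ₁ , 𝒦₁ , c′ , g , h ← f Δ =
    Λ , Δ , 𝒦₀ ++ ℋ , (t ◅ ≋-++ k (≋-sym q) ◅ ≋-∷ (≋-shift _ 𝒦₀ ℋ)) ,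
    step c′ (Perm.prep g ≋-refl) (≋-++ h ≋-refl)
  ... | inj₂ (ℳ′ , q , r) with ≋-∷-inv q
  ...   | inj₁ (p , q′) with Λ , 𝒦₀ , k , f ← local-frame c (↭-sym p) y∉
                        with Γ₁ , 𝒦₁ , c′ , g , h ← f Γ =
    Γ , Λ , 𝒦₀ ++ ℋ ,
    (t ◅ ≋-++ k (r ◅ ≋-∷ (≋-sym q′)) ◅ ≋-∷ (≋-shift _ 𝒦₀ ℋ) ◅ ≋-swap) ,
    step c′ (Perm.prep (↭-trans (++-comm Γ Δ) g) ≋-refl)
            (≋-++ (Perm.prep (++-comm Γ Λ) ≋-refl ◅ h) ≋-refl)
  ...   | inj₂ (ℳ″ , q′ , r′) =
    Γ , Δ , 𝒦 ++ ℳ″ ,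
    (t ◅ ≋-++ (≋-refl {𝒢 = 𝒦}) (r ◅ ≋-∷ r′) ◅ ≋-shift _ 𝒦 _ ◅ ≋-∷ (≋-shift _ 𝒦 ℳ″)) ,
    step c (≋-∷ q′ ◅ ≋-swap) (≋-sym (≋-shift _ 𝒦 ℳ″))

  -- Since `x` occurs only once, the alternatives of the two inversions that do not match the heads
  -- would produce a second occurrence.
  same-env : Unique (names (((x , T) ∷ Γ) ∷ ℋ)) → ((x , T) ∷ Γ) ∷ ℋ ≋ ((x , U) ∷ Γ′) ∷ ℋ′ →
             T ≡ U × Γ ↭ Γ′ × ℋ ≋ ℋ′
  same-env {Γ = Γ} {ℋ = ℋ} u e with ≋-∷-inv e
  ... | inj₂ (_ , q , _) =
    ⊥-elim (head∉ u (subst (_ ∈_) (sym (names-∷ Γ ℋ)) (∈-++⁺ʳ (dom Γ) (names-≋ (≋-sym q) (here refl)))))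
  ... | inj₁ (p , q) with ∷-inv-↭ p
  ...   | inj₁ (refl , r)  = refl , r , q
  ...   | inj₂ (_ , r , _) =
    ⊥-elim (head∉ u (subst (_ ∈_) (sym (names-∷ Γ ℋ)) (∈-++⁺ˡ (dom-↭ (↭-sym r) (here refl)))))

  Unique-tail : (Γ : Env n) (𝒢 : HEnv n) → Unique (names (Γ ∷ 𝒢)) → Unique (names 𝒢)
  Unique-tail []      𝒢 u = u
  Unique-tail (_ ∷ Γ) 𝒢 u = Unique-tail Γ 𝒢 (tail! u)

  cut-≋ : Unique (names (((x , A) ∷ Γ) ∷ ((y , B) ∷ Δ) ∷ ℋ)) →
          ((x , A) ∷ Γ) ∷ ((y , B) ∷ Δ) ∷ ℋ ≋ ((x , A) ∷ Γ′) ∷ ((y , B) ∷ Δ′) ∷ ℋ′ →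
          (Γ ++ Δ) ∷ ℋ ≋ (Γ′ ++ Δ′) ∷ ℋ′
  cut-≋ {Γ = Γ} {y = y} {B = B} {Δ = Δ} {ℋ = ℋ} u e
    with _ , p , e′ ← same-env u e
    with _ , q , e″ ← same-env (Unique-tail Γ (((y , B) ∷ Δ) ∷ ℋ) (tail! u)) e′ = Perm.prep (++⁺ p q) e″

  Unique-cut : 𝒢 ≋ ((x , A) ∷ Γ) ∷ ((y , B) ∷ Δ) ∷ ℋ → Unique (names 𝒢) → Unique (names ((Γ ++ Δ) ∷ ℋ))
  Unique-cut {x = x} {A = A} {Γ = Γ} {y = y} {B = B} {Δ = Δ} {ℋ = ℋ} e u =
    tail! (tail! (Unique-↭ (map⁺ proj₁ (merge-↭ (x , A) (y , B) Γ Δ (concat ℋ))) (Unique-≋ e u)))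

  cut-steps : x ∉ fnᵃ a ++ fnᵃ b → y ∉ fnᵃ a ++ fnᵃ b →
              Steps a b (((x , A) ∷ Γ) ∷ ((y , B) ∷ Δ) ∷ ℋ) 𝒢′ →
              CutTarget (Steps a b) (x , A) (y , B) ((Γ ++ Δ) ∷ ℋ) 𝒢′
  cut-steps {a = a} x∉ y∉ (_ , u , s , t)
    with Γ₁ , Δ₁ , ℋ₁ , e₁ , s′ ← cut-step (x∉ ∘ ∈-++⁺ˡ) (y∉ ∘ ∈-++⁺ˡ) s
    with Γ₂ , Δ₂ , ℋ₂ , e₂ , t′ ← cut-step (x∉ ∘ ∈-++⁺ʳ (fnᵃ a)) (y∉ ∘ ∈-++⁺ʳ (fnᵃ a))
                                           (step-resp-≋ (≋-sym e₁) ≋-refl t) =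
    Γ₂ , Δ₂ , ℋ₂ , e₂ , _ , Unique-cut e₁ u , s′ , t′

  cut-effect : ∀ l → Unique (names 𝒢′) → x ∉ fnˡ l → y ∉ fnˡ l →
               Effect l (((x , A) ∷ Γ) ∷ ((y , B) ∷ Δ) ∷ ℋ) 𝒢′ →
               CutTarget (Effect l) (x , A) (y , B) ((Γ ++ Δ) ∷ ℋ) 𝒢′
  cut-effect τ          u x∉ y∉ e = _ , _ , _ , ≋-sym e , ≋-refl
  cut-effect (link _ _) u x∉ y∉ s = cut-step x∉ y∉ s
  cut-effect (act _)    u x∉ y∉ s = cut-step x∉ y∉ s
  cut-effect (pair a b) u x∉ y∉ (s , t)
    -- The two orders may decompose the same target differently. Its names are distinct, so `cut-≋`
    -- identifies the two results of the cut.
    with Γ₁ , Δ₁ , ℋ₁ , e₁ , s′ ← cut-steps x∉ y∉ s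
    with Γ₂ , Δ₂ , ℋ₂ , e₂ , t′ ← cut-steps (x∉ ∘ ∈-resp-↭ (++-comm (fnᵃ b) (fnᵃ a)))
                                            (y∉ ∘ ∈-resp-↭ (++-comm (fnᵃ b) (fnᵃ a))) t =
    Γ₁ , Δ₁ , ℋ₁ , e₁ , s′ ,
    steps-resp-≋ ≋-refl (cut-≋ {ℋ = ℋ₁} (Unique-≋ e₁ u) (≋-sym e₁ ◅ e₂)) t′

  -- Actions whose subject is known.

  Replaces : Act n → Set
  Replaces (out _ _) = ⊥
  Replaces (close _) = ⊥
  Replaces _         = ⊤

  -- `out` splits its environment and `close` deletes it; `Replaces` excludes both, which leaves
  -- only `replace`.
  local-replace : Replaces a → Local (act a) Γ 𝒦 →
                  ∃₂ λ T Θ → ∃ λ Δ → Replace a T Θ × Γ ≡ (subject a , T) ∷ Δ × 𝒦 ≡ [ Θ ++ Δ ]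
  local-replace _ (replace r) = _ , _ , _ , r , refl , refl

  -- By `same-env` the redex of the step is the displayed environment of the subject, so the type
  -- replaced is the displayed `T`.
  replace-at : ∀ a {_ : Replaces a} → Unique (names 𝒢) → 𝒢 ≋ ((subject a , T) ∷ Γ) ∷ ℋ →
               Step (act a) 𝒢 𝒢′ → ∃ λ Θ → Replace a T Θ × 𝒢′ ≋ (Θ ++ Γ) ∷ ℋ
  replace-at a {ok} u e (step c s t)
    with _ , Θ , Δ , r , refl , refl ← local-replace ok c
    with refl , p , e′ ← same-env (Unique-≋ e u) (≋-sym e ◅ s) =
    Θ , r , (t ◅ Perm.prep (++⁺ˡ Θ (↭-sym p)) (≋-sym e′))

  -- Applied to the premise of a cut, where `T` and `U` are dual. The second action is located by
  -- means of the distinctness recorded for the intermediate hyperenvironment.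
  replace-pair : ∀ a b {_ : Replaces a} {_ : Replaces b} →
                 Unique (names (((subject a , T) ∷ Γ) ∷ ((subject b , U) ∷ Δ) ∷ ℋ)) →
                 Steps a b (((subject a , T) ∷ Γ) ∷ ((subject b , U) ∷ Δ) ∷ ℋ) 𝒢′ →
                 ∃₂ λ Θ Λ → Replace a T Θ × Replace b U Λ × 𝒢′ ≋ (Θ ++ Γ) ∷ (Λ ++ Δ) ∷ ℋ
  replace-pair a b {ok-a} {ok-b} u (_ , u₁ , s , t)
    with Θ , r , e ← replace-at a {ok-a} u ≋-refl s
    with Λ , r′ , e′ ← replace-at b {ok-b} u₁ (e ◅ ≋-swap) t = Θ , Λ , r , r′ , (e′ ◅ ≋-swap)

  -- Erasure

  erase : {D : P ⊢ 𝒢} {D′ : P′ ⊢ 𝒢′} → D —[ l ]→ᵈ D′ → P —[ l ]→ P′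
  erase (exchˢ t)                 = erase t
  erase (exchᵗ t)                 = erase t
  erase out                       = out
  erase inp                       = inp
  erase close                     = close
  erase wait                      = wait
  erase inl                       = inl
  erase inr                       = inr
  erase outT                      = outT
  erase use                       = use
  erase serve                     = serve
  erase coinl                     = coinl
  erase coinr                     = coinr
  erase inpT                      = inpT
  erase drop                      = drop
  erase (dup e)                   = dup
  erase (codrop p en u)           = codrop en
  erase (codup e c)               = codup c
  erase link₁                     = link₁
  erase link₂                     = link₂
  erase (alpha p t)               = alpha p (erase t)
  erase (parˡ t d)                = parˡ (erase t) d
  erase (parʳ t d)                = parʳ (erase t) d
  erase (syn s t d d₁ d₂)         = syn (erase s) (erase t) d d₁ d₂
  erase (flip t)                  = flip (erase t)
  erase (res t x∉ y∉)             = res (erase t) x∉ y∉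
  erase (τ-close t)               = τ-close (erase t)
  erase (τ-out e t)               = τ-out (erase t)
  erase (τ-inl t)                 = τ-inl (erase t)
  erase (τ-inr t)                 = τ-inr (erase t)
  erase (τ-outT t)                = τ-outT (erase t)
  erase (τ-drop t)                = τ-drop (erase t)
  erase (τ-use t)                 = τ-use (erase t)
  erase (τ-dup t)                 = τ-dup (erase t)
  erase (τ-link inj t z≢x z≢y)    = τ-link (erase t) z≢x z≢y

  -- Reordering the context of a server.

  -- A server transition may enumerate the free names in any order, and `codrop` and `codup` on
  -- derivations need the context listed in that order. Induction on `zs` extracts the entry of each
  -- name in turn.
  arrange : ∀ {zs} (Γ : Env n) → Unique zs → Unique (dom Γ) → (∀ z → z ∈ zs ⇔ z ∈ dom Γ) →
            ∃ λ Γ′ → Γ ↭ Γ′ × dom Γ′ ≡ zs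
  arrange {zs = []} []      u v h = [] , ↭-refl , refl
  arrange {zs = []} (_ ∷ Γ) u v h with () ← Equivalence.from (h _) (here refl)
  arrange {zs = z ∷ zs} Γ u v h
    with (_ , A) , c∈ , refl ← ∈-map⁻ proj₁ (Equivalence.to (h z) (here refl))
    with as , bs , refl ← ∈-∃++ c∈ = extend (arrange Γ₀ (tail! u) (tail! v′) (λ w → mk⇔ to from))
    where
    Γ₀ = as ++ bs
    p : as ++ (z , A) ∷ bs ↭ (z , A) ∷ Γ₀
    p = shift (z , A) as bs
    v′ : Unique (z ∷ dom Γ₀)
    v′ = Unique-↭ (map⁺ proj₁ p) v
    to : w ∈ zs → w ∈ dom Γ₀
    to w∈ with dom-↭ p (Equivalence.to (h _) (there w∈))
    ... | here refl = ⊥-elim (head∉ u w∈)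
    ... | there w∈′ = w∈′
    from : w ∈ dom Γ₀ → w ∈ zs
    from w∈ with Equivalence.from (h _) (dom-↭ (↭-sym p) (there w∈))
    ... | here refl = ⊥-elim (head∉ v′ w∈)
    ... | there w∈′ = w∈′
    extend : (∃ λ Γ′ → Γ₀ ↭ Γ′ × dom Γ′ ≡ zs) → ∃ λ Γ′ → as ++ (z , A) ∷ bs ↭ Γ′ × dom Γ′ ≡ z ∷ zs
    extend (Γ′ , q , eq) = (z , A) ∷ Γ′ , ↭-trans p (↭.prep _ q) , cong (z ∷_) eq

  Unique-server : P ⊢ [ (y , A) ∷ ？ᵉ Γ ] → Unique (dom Γ)
  Unique-server {Γ = Γ} D = subst Unique (trans (names-[] (？ᵉ Γ)) (dom-map₂ ？_ Γ)) (tail! (distinct D))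

  arrange-server : ∀ {zs} → P ⊢ [ (y , A) ∷ ？ᵉ Γ ] → zs Enumerates (fn P ∖ y) →
                   ∃ λ Γ′ → Γ ↭ Γ′ × dom Γ′ ≡ zs
  arrange-server {P = P} {y = y} {Γ = Γ} {zs = zs} D (u , h) =
    arrange Γ u (Unique-server D) (λ z → mk⇔ to from)
    where
    names≡ : names [ ？ᵉ Γ ] ≡ dom Γ
    names≡ = trans (names-[] (？ᵉ Γ)) (dom-map₂ ？_ Γ)
    to : z ∈ zs → z ∈ dom Γ
    to z∈ with z∈P , z≢y ← ∈-∖⁻ (fn P) (Equivalence.to (h _) z∈) with fn⊆names D z∈P
    ... | here refl = ⊥-elim (z≢y refl)
    ... | there z∈′ = subst (_ ∈_) names≡ z∈′
    from : z ∈ dom Γ → z ∈ zs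
    from z∈ with z∈′ ← subst (_ ∈_) (sym names≡) z∈ =
      Equivalence.from (h _) (∈-∖⁺ (names⊆fn D (there z∈′)) (∈⇒≢ z∈′ (head∉ (distinct D))))

  -- Lifting process transitions to derivations.

  disjoint-after : ∀ l (ℋ : HEnv n) → Effect l 𝒢 𝒢′ → Disjoint (names 𝒢) (names ℋ) →
                   Disjoint (bnˡ l) (names ℋ) → Disjoint (names 𝒢′) (names ℋ)
  disjoint-after l ℋ f d d′ (z∈𝒢′ , z∈ℋ) with effect-names l f z∈𝒢′
  ... | inj₁ z∈𝒢 = d (z∈𝒢 , z∈ℋ)
  ... | inj₂ z∈l = d′ (z∈l , z∈ℋ)

  disjoint-names : ∀ {xs} → Q ⊢ ℋ → Disjoint xs (fn Q) → Disjoint xs (names ℋ)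
  disjoint-names E d (p , q) = d (p , names⊆fn E q)

  -- The update could only identify `x` with `z`, and `z` is not free in `P`.
  redirect-injective : z ∉ names (((x , A) ∷ Γ) ∷ 𝒢) → (D : P ⊢ ((x , A) ∷ Γ) ∷ 𝒢) →
                       InjectiveOn (id [ x ↦ z ]) (fn P)
  redirect-injective {P = P} z∉ D =
    update-injective id (fn P) (λ _ _ eq → eq) (z∉ ∘ fn⊆names D ∘ subst (_ ∈_) (map-id (fn P)))

  -- The `Effect` strengthens the induction: it gives the target of a premise the shape that `cut`
  -- demands. The recursion is lexicographic, since `exch` shortens only the derivation, while
  -- `alpha` shortens the transition and changes the derivation.
  lift : P —[ l ]→ P′ → (D : P ⊢ 𝒢) → ∃ λ 𝒢′ → Σ (P′ ⊢ 𝒢′) λ D′ → Effect l 𝒢 𝒢′ × D —[ l ]→ᵈ D′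
  lift {l = l} t (exch e D) with _ , D′ , f , d ← lift t D =
    _ , D′ , effect-resp-≋ l (≋-sym e) ≋-refl f , exchˢ d
  lift out (tensor D) = _ , D , step out ≋-refl ≋-refl , out
  lift inp (par D) = _ , D , step (replace inp) ≋-refl ≋-refl , inp
  lift close (one D) = _ , D , step close ≋-refl ≋-refl , close
  lift wait (bot D x∉) = _ , D , step (replace wait) ≋-refl ≋-refl , wait
  lift inl (plus₁ D) = _ , D , step (replace inl) ≋-refl ≋-refl , inl
  lift inr (plus₂ D) = _ , D , step (replace inr) ≋-refl ≋-refl , inr
  lift outT (ex D) = _ , D , step (replace outT) ≋-refl ≋-refl , outT
  lift use (quest D x∉) = _ , D , step (replace use) ≋-refl ≋-refl , use
  lift serve (bang D x∉) = _ , D , step (replace serve) ≋-refl ≋-refl , serve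
  lift coinl (with& D E) = _ , D , step (replace coinl) ≋-refl ≋-refl , coinl
  lift coinr (with& D E) = _ , E , step (replace coinr) ≋-refl ≋-refl , coinr
  lift (inpT {A = A}) (all {x = x} {B = B} {Γ = Γ} D) =
    _ , subD (inst A) D ,
    step (replace inpT) ≋-refl (≋-reflexive (cong (λ Θ → [ (x , B [ A ]ᵗ) ∷ Θ ]) (subᵉ-inst-wk A Γ))) ,
    inpT
  lift drop (weak D x∉) = _ , bot D x∉ , step (replace drop) ≋-refl ≋-refl , drop
  lift dup (contr D x∉) =
    _ , par (exch _ D) , step (replace dup) ≋-refl ≋-refl ,
    dup (Perm.prep (↭.swap _ _ ↭-refl) ≋-refl)
  lift (codrop en) (bang {Γ = Γ} {x = x} D x∉) with Γ′ , p , refl ← arrange-server D en =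
    _ , dropsD Γ′ u (one mix₀) ,
    step (replace codrop) ≋-refl
         (Perm.prep (↭-trans (++-comm (？ᵉ Γ′) [ (x , 𝟏) ]) (↭.prep _ (map⁺ _ (↭-sym p)))) ≋-refl) ,
    codrop p en u
    where
    u : Unique (dom (Γ′ ++ [ (x , 𝟏) ]))
    u = Unique-↭ (map⁺ proj₁ (↭-trans (↭.prep (x , 𝟏) p) (++-comm [ (x , 𝟏) ] Γ′)))
                 (x∉ ∷! Unique-server D)
  lift (codup {x₁ = x₁} c) (bang {A = A} {Γ = Γ} D x∉)
    with Γ′ , p , refl ← arrange-server D (Copying.enumerates c) =
    _ , copyD {Γ = Γ′} c (exch e D) ,
    step (replace codup) ≋-refl
         (Perm.prep (↭-trans (++-comm (？ᵉ Γ′) [ (x₁ , ！ A ⊗ ！ A) ]) (↭.prep _ (map⁺ _ (↭-sym p)))) ≋-refl) ,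
    codup e c
    where
    e = Perm.prep (↭.prep _ (map⁺ _ p)) ≋-refl
  lift link₁ (ax x≢y) = _ , mix₀ , step link ≋-refl ≋-refl , link₁
  lift link₂ (ax {x = x} {y = y} {A = A} x≢y) =
    _ , mix₀ ,
    -- Read from `y` to `x`, the link has type parameter `dual A`, so `y` gets its double dual.
    step link (Perm.prep (↭-trans (↭.swap _ _ ↭-refl)
                 (↭-reflexive (cong (λ B → (y , B) ∷ (x , dual A) ∷ []) (sym (dual-involutive A))))) ≋-refl)
         ≋-refl ,
    link₂
  lift (alpha p t) D with _ , D′ , f , d ← lift t (⊢-resp-α p D) = _ , D′ , f , alpha p d
  lift {l = l} (parˡ t b) (mix {ℋ = ℋ} D E d) with _ , D′ , f , s ← lift t D =
    _ , mix D′ E (disjoint-after l ℋ f d (disjoint-names E b)) ,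
    effect-++ l ℋ (distinct E) d (disjoint-names E b) f , parˡ s b
  lift {l = l} (parʳ t b) (mix {𝒢 = 𝒢} {ℋ = ℋ} D E d) with ℋ′ , E′ , f , s ← lift t E =
    _ , mix D E′ (disjoint-after l 𝒢 f (d ∘ swap) (disjoint-names D b) ∘ swap) ,
    effect-resp-≋ l (≋-++-comm 𝒢 ℋ) (≋-++-comm 𝒢 ℋ′)
      (effect-++ l 𝒢 (distinct D) (d ∘ swap) (disjoint-names D b) f) ,
    parʳ s b
  lift (syn {a = a} {b = b} s t bb bQ bP) (mix {𝒢 = 𝒢} {ℋ = ℋ} D E d)
    with 𝒢′ , D′ , f , s′ ← lift s D
       | ℋ′ , E′ , g , t′ ← lift t E =
    _ , mix D′ E′ d″ ,
    -- The intermediate hyperenvironments arise when only one component moves; a `mix` with the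
    -- other, unmoved component shows their names distinct.
    ((_ , distinct (mix D′ E dˡ) , step-++ ℋ f , step-++ʳ 𝒢′ g) ,
     (_ , distinct (mix D E′ dʳ) , step-++ʳ 𝒢 g , step-++ ℋ′ f)) ,
    syn s′ t′ bb bQ bP
    where
    step-++ʳ : ∀ 𝒦 → Step (act b) ℋ ℋ′ → Step (act b) (𝒦 ++ ℋ) (𝒦 ++ ℋ′)
    step-++ʳ 𝒦 s = step-resp-≋ (≋-++-comm 𝒦 ℋ) (≋-++-comm 𝒦 ℋ′) (step-++ 𝒦 s)
    dˡ : Disjoint (names 𝒢′) (names ℋ)
    dˡ = disjoint-after (act a) ℋ f d (disjoint-names E bQ)
    dʳ : Disjoint (names 𝒢) (names ℋ′)
    dʳ = disjoint-after (act b) 𝒢 g (d ∘ swap) (disjoint-names D bP) ∘ swap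
    bℋ′ : Disjoint (bnᵃ a) (names ℋ′)
    bℋ′ (p , q) with step-names g q
    ... | inj₁ q′ = disjoint-names E bQ (p , q′)
    ... | inj₂ q′ = bb (p , q′)
    d″ : Disjoint (names 𝒢′) (names ℋ′)
    d″ = disjoint-after (act a) ℋ′ f dʳ bℋ′
  lift (flip t) D with _ , D′ , (f , g) , d ← lift t D = _ , D′ , (g , f) , flip d
  lift {l = l} (res t x∉ y∉) (cut {A = A} D)
    with _ , D′ , f , d ← lift t D
    with _ , _ , _ , e , f′ ← cut-effect l (distinct D′) (x∉ ∘ ∈-++⁺ˡ) (y∉ ∘ ∈-++⁺ˡ) f =
    _ , cut {A = A} (exch e D′) , f′ , res (exchᵗ d) x∉ y∉
  lift (τ-close {x = x} {y = y} t) (cut D)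
    with _ , D′ , ((_ , u , step close s e , f) , _) , d ← lift t D
    with refl , p , e′ ← same-env (distinct D) s
    -- A `close` redex has a single entry, so `Γ` is empty and the cut yields just `Δ`.
    with refl ← ↭-empty-inv p
    with _ , wait , e″ ← replace-at (wait y) u (e ◅ ≋-sym e′) f =
    _ , exch e″ D′ , ≋-refl , τ-close (exchᵗ d)
  lift (τ-out {x = x} {x′ = x′} {y = y} {y′ = y′} t) (cut {Γ = Γ} {Δ = Δ} {𝒢 = 𝒢} D)
    with _ , D′ , ((_ , u , step (out {A = A} {B = B} {Γ = Γ₂} {Δ = Γ₁}) s e , f) , _) , d ← lift t D
    with refl , p , e′ ← same-env (distinct D) s
    with _ , inp , e″ ← replace-at (inp y y′) u
           (e ◅ ≋-∷ (≋-∷ (≋-sym e′)) ◅ ≋-∷ ≋-swap ◅ ≋-swap) f =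
    _ , cut {A = B} (exch order (cut {A = A} (exch (e″ ◅ ≋-swap) D′))) ,
    (Perm.prep (↭-trans (++⁺ʳ Δ q) (↭-reflexive (++-assoc Γ₁ Γ₂ Δ))) ≋-refl) ,
    -- `τ-out` wants the context of `x` in the form `Γ₁ ++ Γ₂`, but `Γ` is only a permutation of it.
    -- `alpha` at `α-refl` passes to another derivation of the same judgement, with `exch` above and
    -- below the cut.
    alpha {E = exch (Perm.prep (++⁺ʳ Δ (↭-sym q)) ≋-refl)
                    (cut {A = A ⊗ B} (exch (Perm.prep (↭.prep _ q) ≋-refl) D))}
          α-refl (exchˢ (τ-out order (exchˢ (exchᵗ d))))
    where
    q : Γ ↭ Γ₁ ++ Γ₂
    q = ↭-trans p (++-comm Γ₂ Γ₁)
    order : (Γ₂ ++ (y , dual B) ∷ Δ) ∷ ((x , B) ∷ Γ₁) ∷ 𝒢 ≋ ((x , B) ∷ Γ₁) ∷ ((y , dual B) ∷ Γ₂ ++ Δ) ∷ 𝒢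
    order = Perm.swap (shift (y , dual B) Γ₂ Δ) ↭-refl ≋-refl
  lift (τ-inl {x = x} {y = y} t) (cut D)
    with _ , D′ , (f , _) , d ← lift t D
    -- Matching `inl` makes the cut type a sum; its dual is then a `&`, and `coinl` leaves the dual
    -- of the same summand.
    with _ , _ , inl , coinl , e ← replace-pair (inl x) (coinl y) (distinct D) f =
    _ , cut (exch e D′) , ≋-refl , τ-inl (exchᵗ d)
  lift (τ-inr {x = x} {y = y} t) (cut D)
    with _ , D′ , (f , _) , d ← lift t D
    with _ , _ , inr , coinr , e ← replace-pair (inr x) (coinr y) (distinct D) f =
    _ , cut (exch e D′) , ≋-refl , τ-inr (exchᵗ d)
  lift (τ-outT {x = x} {A = A} {y = y} t) (cut {Γ = Γ} {Δ = Δ} {𝒢 = 𝒢} D)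
    with _ , D′ , (f , _) , d ← lift t D
    with _ , _ , outT {B = B} , inpT , e ← replace-pair (outT x A) (inpT y A) (distinct D) f =
    _ , cut {A = B [ A ]ᵗ} (exch (e ◅ ≋-reflexive (eq B)) D′) , ≋-refl , τ-outT (exchᵗ d)
    where
    -- The endpoints instantiate `B` and `dual B` separately; duality commutes with substitution.
    eq : ∀ B → ((x , B [ A ]ᵗ) ∷ Γ) ∷ ((y , dual B [ A ]ᵗ) ∷ Δ) ∷ 𝒢 ≡
               ((x , B [ A ]ᵗ) ∷ Γ) ∷ ((y , dual (B [ A ]ᵗ)) ∷ Δ) ∷ 𝒢
    eq B = cong (λ C → ((x , B [ A ]ᵗ) ∷ Γ) ∷ ((y , C) ∷ Δ) ∷ 𝒢) (sub-dual (inst A) B)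
  lift (τ-drop {x = x} {y = y} t) (cut D)
    with _ , D′ , (f , _) , d ← lift t D
    with _ , _ , drop , codrop , e ← replace-pair (drop x) (codrop y) (distinct D) f =
    _ , cut (exch e D′) , ≋-refl , τ-drop (exchᵗ d)
  lift (τ-use {x = x} {x′ = x′} {y = y} {y′ = y′} t) (cut D)
    with _ , D′ , (f , _) , d ← lift t D
    with _ , _ , use , serve , e ← replace-pair (use x x′) (serve y y′) (distinct D) f =
    _ , cut (exch e D′) , ≋-refl , τ-use (exchᵗ d)
  lift (τ-dup {x = x} {x₁ = x₁} {x₂ = x₂} {y = y} {y₁ = y₁} {y₂ = y₂} t) (cut D)
    with _ , D′ , (f , _) , d ← lift t D
    with _ , _ , dup , codup , e ← replace-pair (dup x x₁ x₂) (codup y y₁ y₂) (distinct D) f =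
    _ , cut (exch e D′) , ≋-refl , τ-dup (exchᵗ d)
  lift (τ-link {z = z} {y = y} {x = x} t z≢x z≢y) (cut {A = A} {Γ = Γ} {Δ = Δ} {𝒢 = 𝒢} D)
    with _ , D′ , step link s e , d ← lift t D
    -- With `y` moved to the front on both sides, its environment is the link itself, so `Δ` is the
    -- single entry of `z` with type `dual (dual A)`.
    with refl , p , e′ ← same-env (Unique-≋ (≋-swap {Γ = (x , A) ∷ Γ} {Δ = (y , dual A) ∷ Δ} {𝒢 = 𝒢}) (distinct D))
                                  (≋-swap ◅ s ◅ Perm.prep (↭.swap _ _ ↭-refl) ≋-refl)
    with refl ← trans (↭-singleton-inv p) (cong (λ B → [ (z , B) ]) (dual-involutive A)) =
    _ , renD (id [ x ↦ z ]) (exch e₀ D′) inj ,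
    (Perm.prep (++-comm Γ [ (z , A) ]) ≋-refl ◅
      ≋-reflexive (sym (renʰ-head (update-same id x z) Γ 𝒢 (λ w∈ → update-other id (∈⇒≢ w∈ x∉))))) ,
    τ-link inj (exchᵗ d) z≢x z≢y
    where
    e₀ = e ◅ ≋-sym e′
    u : Unique (y ∷ z ∷ x ∷ names (Γ ∷ 𝒢))
    u = Unique-≋ (≋-swap {Γ = (x , A) ∷ Γ} {Δ = (y , dual A) ∷ (z , A) ∷ []} {𝒢 = 𝒢}) (distinct D)
    x∉ = head∉ (tail! (tail! u))
    inj = redirect-injective (head∉ (tail! u)) (exch e₀ D′)

theorem4p10 : (N : Names) → let open πLL N in
    (n : ℕ) (D : Derivation n) (l : Label n) →
    ((D′ : Derivation n) → D —[ l ]→ᴰ D′ → proc D —[ l ]→ proc D′)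
    × ((P′ : Proc n) → proc D —[ l ]→ P′ →
    Σ (Derivation n) λ D′ → (D —[ l ]→ᴰ D′) × (proc D′ ≡ P′))
theorem4p10 N n D l =
  (λ D′ t → erase t) ,
  (λ P′ t → let 𝒢′ , D′ , _ , d = lift t (tree D) in derivation D′ , d , refl)
  where
  open πLL N
  open Erasure N
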